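{- Let $n\ge2$. Let $C=(\tau\overset{c}{\Rightarrow}\kappa)$ be a strong marked cover of symmetric $2n$-cores with marking $m(C)=c$. Assume that $\tau=\mathfrak{a}(w)$ and $\kappa=\mathfrak{a}(u)$ with $w,u\in\widetilde{C}_n^0$. Then $u=w\,t^c_{i,j}$ for some $i,j\in\mathbb{Z}\setminus(n+1)\mathbb{Z}$ (with $i\not\equiv j \pmod{2n+2}$, so that $t^c_{i,j}$ is defined) such that $$w(j)=u(i)=c+\left\lfloor \frac{c}{n}\right\rfloor+1 .$$
   Context: **The group.** $\widetilde{C}_n$ is the affine Weyl group of type C, with generators $s_0,s_1,\dots,s_n$ and relations $s_i^2=1$; $s_is_j=s_js_i$ if $|i-j|>1$; $s_is_{i+1}s_i=s_{i+1}s_is_{i+1}$ for $1\le i\le n-2$; $s_0s_1s_0s_1=s_1s_0s_1s_0$; $s_{n-1}s_ns_{n-1}s_n=s_ns_{n-1}s_ns_{n-1}$. $\ell(w)$ denotes the length of $w$ (number of letters in a shortest expression in the generators). It is realized (faithfully) as a group of permutations of $\mathbb{Z}$ under composition (congruences modulo $2n+2$): for $0<i<n$, $s_i(x)=x+1$ if $x\equiv i$ or $-i-1$, $s_i(x)=x-1$ if $x\equiv i+1$ or $-i$, and $s_i(x)=x$ otherwise; $s_0(x)=x+2$ if $x\equiv-1$, $x-2$ if $x\equiv1$, $x$ otherwise; $s_n(x)=x+2$ if $x\equiv n$, $x-2$ if $x\equiv n+2$, $x$ otherwise. $\widetilde{C}_n^0$ is the set of affine Grassmannian elements, i.e. the minimal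 length representatives of the cosets in $\widetilde{C}_n/C_n$ where $C_n=\langle s_1,\dots,s_n\rangle$. **Type C transpositions.** For $i,j\in\mathbb{Z}\setminus(n+1)\mathbb{Z}$ with $i\not\equiv j\pmod{2n+2}$, $t^c_{i,j}$ is the unique element of $\widetilde{C}_n$ such that for all $q\in\mathbb{Z}$: $i+q(2n+2)\mapsto j+q(2n+2)$, $j+q(2n+2)\mapsto i+q(2n+2)$, $-i+q(2n+2)\mapsto -j+q(2n+2)$, $-j+q(2n+2)\mapsto -i+q(2n+2)$, and all other integers are fixed. **Cores.** The Young diagram of a partition $\lambda$ is $\mathrm{dg}(\lambda)=\{(r,c)\in\mathbb{Z}_{\ge1}^2: c\le\lambda_r\}$ in French notation (row index $r$ increases from south to north, column index $c$ from west to east). The hook length of a box is the number of boxes strictly above it in its column plus the number weakly to its right in its row (including itself). A $2n$-core is a partition whose diagram has no box of hook length $2n$. $\mathcal{C}_{2n}^c$ denotes the set of symmetric $2n$-cores ($(i,j)\in\mathrm{dg}(\kappa)$ iff $(j,i)\in\mathrm{dg}(\kappa)$). The content of a box $(i,j)$ is $j-i$; its residue is its content modulo $2n$. An addable (removable) corner of $\lambda$ is a box outside (inside) $\mathrm{dg}(\lambda)$ whose addition (removal) gives the diagram of a partition. **Action and bijection.** $\widetilde{C}_n$ acts on $\mathcal{C}_{2n}^c$ by (for $i\in[0,n]$): if $\kappa$ has at least one addable corner of residue $i$, then $s_i\cdot\kappa$ is obtained by adding all addable corners of residue $i$ or $2n-i$ modulo $2n$; if $\kappa$ has at least one removable corner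 of residue $i$, then $s_i\cdot\kappa$ is obtained by removing all removable corners of residue $i$ or $2n-i$ modulo $2n$; otherwise $s_i\cdot\kappa=\kappa$. It is known that this is a well-defined group action and that $\mathfrak{a}:\widetilde{C}_n^0\to\mathcal{C}_{2n}^c$, $w\mapsto w\cdot\emptyset$, is a bijection. **Strong marked covers.** For $\tau,\kappa\in\mathcal{C}_{2n}^c$, $\tau\Rightarrow\kappa$ is a strong cover if $\mathrm{dg}(\tau)\subset\mathrm{dg}(\kappa)$ and $\ell(\mathfrak{a}^{ -1}(\kappa))=\ell(\mathfrak{a}^{ -1}(\tau))+1$. In this case it is known that $\kappa/\tau=\mathrm{dg}(\kappa)\setminus\mathrm{dg}(\tau)$ is a collection of disjoint ribbons (its connected components, where boxes are connected by sharing edges; a ribbon is a connected set of boxes containing no $2\times2$ square). A strong marked cover $\tau\overset{c}{\Rightarrow}\kappa$ is a strong cover $\tau\Rightarrow\kappa$ together with an integer $c$ (the marking) that is the content of the most southeast box of one of the ribbons of $\kappa/\tau$. -}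

module Defs where

open import Data.Bool.Base using (if_then_else_)
open import Data.Empty using (⊥-elim)
open import Data.Fin.Base using (Fin; zero; toℕ)
open import Data.Integer.Base as ℤ using (ℤ; +_; -_)
open import Data.Integer.Divisibility.Signed using (_∣_; _∣?_)
open import Data.List.Base using (List; []; _∷_; _++_; length; filter; drop)
open import Data.List.Relation.Unary.All using (All; [])
open import Data.List.Relation.Unary.Linked using (Linked; [])
open import Data.Nat.Base using (ℕ; zero; suc; _≤_; _≥_; _<_; _∸_; _+_; _*_)
open import Data.Nat.Properties using (_≤?_; _≟_; <⇒≱)
open import Data.Product.Base using (Σ; ∃; _×_; _,_; proj₁; proj₂)
open import Data.Sum.Base using (_⊎_)
open import Function.Bundles using (_⇔_; mk⇔)
open import Function.Base using (_∘_)
open import Level using (0ℓ)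
open import Relation.Binary.Construct.Closure.ReflexiveTransitive using (Star)
open import Relation.Binary.PropositionalEquality using (_≡_; _≢_; _≗_)
open import Relation.Nullary using (¬_; Dec; does; _⊎-dec_)
open import Relation.Unary using (Pred; _∈_; _∉_; _⊆_; _≐_; _∪_; _∩_; _∖_; ｛_｝)

infix 4 _≡_[mod_] _≢_[mod_]

_≡_[mod_] : ℤ → ℤ → ℕ → Set
x ≡ y [mod m ] = + m ∣ x ℤ.- y

_≢_[mod_] : ℤ → ℤ → ℕ → Set
x ≢ y [mod m ] = ¬ (x ≡ y [mod m ])

congruent? : (m : ℕ) (x y : ℤ) → Dec (x ≡ y [mod m ])
congruent? m x y = + m ∣? x ℤ.- y

period : ℕ → ℕ
period n = 2 * n + 2

s₀ : ℕ → ℤ → ℤ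
s₀ n x =
  if does (congruent? (period n) x (- (+ 1))) then x ℤ.+ + 2 else
  if does (congruent? (period n) x (+ 1))     then x ℤ.- + 2 else x

sₙ : ℕ → ℤ → ℤ
sₙ n x =
  if does (congruent? (period n) x (+ n))       then x ℤ.+ + 2 else
  if does (congruent? (period n) x (+ (n + 2))) then x ℤ.- + 2 else x

sᵢ : ℕ → ℕ → ℤ → ℤ
sᵢ n i x =
  if does (congruent? (period n) x (+ i) ⊎-dec congruent? (period n) x (- (+ i) ℤ.- + 1))
    then x ℤ.+ + 1 else
  if does (congruent? (period n) x (+ (i + 1)) ⊎-dec congruent? (period n) x (- (+ i)))
    then x ℤ.- + 1 else x

gen : (n : ℕ) → Fin (suc n) → ℤ → ℤ
gen n i =
  if does (toℕ i ≟ 0) then s₀ n else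
  if does (toℕ i ≟ n) then sₙ n else sᵢ n (toℕ i)

-- The affine Weyl group of type C, in its faithful realization by
-- permutations of ℤ: a group element is represented by a word in the generators; two words
-- are the same element when they induce the same permutation. Since the
-- generators are involutions, words exhaust the group. The product is _++_.
C̃ : ℕ → Set
C̃ n = List (Fin (suc n))

⟦_⟧ : ∀ {n} → C̃ n → ℤ → ℤ
⟦ [] ⟧        x = x
⟦_⟧ {n} (i ∷ w) x = gen n i (⟦ w ⟧ x)

infix 4 _≈_

_≈_ : ∀ {n} → C̃ n → C̃ n → Set
w ≈ v = ⟦ w ⟧ ≗ ⟦ v ⟧

-- ℓ w is m
HasLength : ∀ {n} → C̃ n → ℕ → Set
HasLength {n} w m =
  (∃ λ (v : C̃ n) → v ≈ w × length v ≡ m) ×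
  (∀ (v : C̃ n) → v ≈ w → m ≤ length v)

-- Words in s₁, …, sₙ.
Finite : ∀ {n} → C̃ n → Set
Finite = All (_≢ zero)

-- w has minimal length in its coset w Cₙ.
AffineGrassmannian : ∀ {n} → C̃ n → Set
AffineGrassmannian {n} w = ∃ λ m → HasLength w m ×
  (∀ (v : C̃ n) → Finite v → ∀ m′ → HasLength (w ++ v) m′ → m ≤ m′)

C̃⁰ : ℕ → Set
C̃⁰ n = Σ (C̃ n) AffineGrassmannian

-- t represents tᶜᵢⱼ
record IsTransposition (n : ℕ) (i j : ℤ) (t : C̃ n) : Set where
  field
    i↦j   : ∀ q → ⟦ t ⟧ (i ℤ.+ q ℤ.* + period n) ≡ j ℤ.+ q ℤ.* + period n
    j↦i   : ∀ q → ⟦ t ⟧ (j ℤ.+ q ℤ.* + period n) ≡ i ℤ.+ q ℤ.* + period n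
    -i↦-j : ∀ q → ⟦ t ⟧ (- i ℤ.+ q ℤ.* + period n) ≡ - j ℤ.+ q ℤ.* + period n
    -j↦-i : ∀ q → ⟦ t ⟧ (- j ℤ.+ q ℤ.* + period n) ≡ - i ℤ.+ q ℤ.* + period n
    fixed : ∀ x → x ≢ i [mod period n ] → x ≢ j [mod period n ] →
            x ≢ - i [mod period n ] → x ≢ - j [mod period n ] → ⟦ t ⟧ x ≡ x

record Partition : Set where
  field
    parts      : List ℕ
    decreasing : Linked _≥_ parts
    positive   : All (0 <_) parts

open Partition public

-- Rows are numbered from 1; row 0 and the rows past the last part have
-- length 0.
part : List ℕ → ℕ → ℕ
part []       _             = 0
part (x ∷ xs) zero          = 0
part (x ∷ xs) (suc zero)    = x
part (x ∷ xs) (suc (suc r)) = part xs (suc r)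

-- (row , column)
Box : Set
Box = ℕ × ℕ

-- 1 ≤ c ≤ part r already forces 1 ≤ r.
dg : Partition → Pred Box 0ℓ
dg μ (r , c) = 1 ≤ c × c ≤ part (parts μ) r

-- Boxes strictly above (r , c): one for each later row of length ≥ c.
-- Boxes weakly to the right: columns c, …, part r.
hook : Partition → Box → ℕ
hook μ (r , c) =
  length (filter (c ≤?_) (drop r (parts μ))) + (suc (part (parts μ) r) ∸ c)

IsCore : ℕ → Partition → Set
IsCore m μ = ∀ b → b ∈ dg μ → hook μ b ≢ m

Symmetric : Partition → Set
Symmetric μ = ∀ r c → ((r , c) ∈ dg μ) ⇔ ((c , r) ∈ dg μ)

record SymmetricCore (n : ℕ) : Set where
  field
    partition : Partition
    symmetric : Symmetric partition
    core      : IsCore (2 * n) partition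

open SymmetricCore public

emptyPartition : Partition
emptyPartition = record { parts = [] ; decreasing = [] ; positive = [] }

emptyCore : ∀ n → SymmetricCore n
emptyCore n = record
  { partition = emptyPartition
  ; symmetric = λ r c → mk⇔ (⊥-elim ∘ noBox (r , c)) (⊥-elim ∘ noBox (c , r))
  ; core      = λ b b∈ → ⊥-elim (noBox b b∈)
  }
  where
  noBox : ∀ b → b ∉ dg emptyPartition
  noBox (r , c) (1≤c , c≤0) = <⇒≱ 1≤c c≤0

diagram : ∀ {n} → SymmetricCore n → Pred Box 0ℓ
diagram κ = dg (partition κ)

content : Box → ℤ
content (r , c) = + c ℤ.- + r

Addable : Partition → Pred Box 0ℓ
Addable μ b = b ∉ dg μ × ∃ λ ν → dg ν ≐ (dg μ ∪ ｛ b ｝)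

Removable : Partition → Pred Box 0ℓ
Removable μ b = b ∈ dg μ × ∃ λ ν → dg ν ≐ (dg μ ∖ ｛ b ｝)

Residue : ℕ → ℤ → Pred Box 0ℓ
Residue n k b = content b ≡ k [mod 2 * n ]

Residue± : (n : ℕ) → Fin (suc n) → Pred Box 0ℓ
Residue± n i = Residue n (+ toℕ i) ∪ Residue n (+ (2 * n) ℤ.- + toℕ i)

AddableAt RemovableAt : ∀ {n} → SymmetricCore n → Fin (suc n) → Pred Box 0ℓ
AddableAt   {n} κ i = Addable   (partition κ) ∩ Residue n (+ toℕ i)
RemovableAt {n} κ i = Removable (partition κ) ∩ Residue n (+ toℕ i)

-- sᵢ · κ is κ′
record GenAction {n : ℕ} (i : Fin (suc n)) (κ κ′ : SymmetricCore n) : Set where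
  field
    adding    : ∃ (AddableAt κ i) →
                diagram κ′ ≐ (diagram κ ∪ (Addable (partition κ) ∩ Residue± n i))
    removing  : ∃ (RemovableAt κ i) →
                diagram κ′ ≐ (diagram κ ∖ (Removable (partition κ) ∩ Residue± n i))
    otherwise : ¬ ∃ (AddableAt κ i) → ¬ ∃ (RemovableAt κ i) →
                diagram κ′ ≐ diagram κ

infix 4 _·_↦_ 𝔞_↦_

-- w · κ is κ′
_·_↦_ : ∀ {n} → C̃ n → SymmetricCore n → SymmetricCore n → Set
[]      · κ ↦ κ′ = diagram κ′ ≐ diagram κ
(i ∷ w) · κ ↦ κ′ = ∃ λ κ″ → (w · κ ↦ κ″) × GenAction i κ″ κ′

-- 𝔞 w is κ
𝔞_↦_ : ∀ {n} → C̃⁰ n → SymmetricCore n → Set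
𝔞_↦_ {n} w κ = proj₁ w · emptyCore n ↦ κ

record StrongCover {n : ℕ} (τ κ : SymmetricCore n) : Set where
  field
    contained : diagram τ ⊆ diagram κ
    -- 𝔞⁻¹ τ and 𝔞⁻¹ κ
    𝔞⁻¹τ 𝔞⁻¹κ : C̃⁰ n
    preimageτ : 𝔞 𝔞⁻¹τ ↦ τ
    preimageκ : 𝔞 𝔞⁻¹κ ↦ κ
    ℓτ        : ℕ
    lengthτ   : HasLength (proj₁ 𝔞⁻¹τ) ℓτ
    lengthκ   : HasLength (proj₁ 𝔞⁻¹κ) (ℓτ + 1)

Adjacent : Box → Box → Set
Adjacent (r , c) (r′ , c′) =
  (r ≡ r′ × (c′ ≡ suc c ⊎ c ≡ suc c′)) ⊎ (c ≡ c′ × (r′ ≡ suc r ⊎ r ≡ suc r′))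

-- b and b′ lie in the same connected component of D, for b in D.
Connected : Pred Box 0ℓ → Box → Box → Set
Connected D = Star (λ b b′ → b ∈ D × b′ ∈ D × Adjacent b b′)

-- b is the most southeast box of its connected component in D. Rows are
-- numbered from south to north, so southernmost means least row index.
SoutheastEnd : Pred Box 0ℓ → Pred Box 0ℓ
SoutheastEnd D b = b ∈ D ×
  (∀ b′ → Connected D b b′ → proj₁ b ≤ proj₁ b′ × proj₂ b′ ≤ proj₂ b)

-- The ribbons of κ/τ are its connected components.
record StrongMarkedCover {n : ℕ} (τ : SymmetricCore n) (c : ℤ) (κ : SymmetricCore n) : Set where
  field
    cover   : StrongCover τ κ
    marking : ∃ λ b → SoutheastEnd (diagram κ ∖ diagram τ) b × content b ≡ c

{-# OPTIONS --safe #-}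
module Submission where

-- Numbering the values ℤ ∖ (n + 1)ℤ increasingly by φ : ℤ → ℤ ∖ (n + 1)ℤ turns every generator sᵢ
-- into the map σᵢ of ℤ that swaps k - 1 and k for all k ≡ ±i modulo 2n, and turns x ↦ -x into
-- k ↦ -1 - k. Step k of the boundary of the core of w is vertical exactly when w⁻¹ sends it to a
-- negative number, so counting vertical steps describes the core by an integer function
-- ("profile") on which sᵢ acts by p(k) ↦ p(k-1) + p(k+1) - p(k), and containment of cores is the
-- pointwise order of profiles.
--
-- This action satisfies the lifting property, hence τ ⊆ κ makes a word for τ appear as a subword
-- of every word for κ. By the exchange property it can be chosen increasing on a window, which
-- makes it a word of the affine Grassmannian element w itself. As the lengths differ by one, a
-- single letter s is deleted from a reduced word a s b of u, and u = w t with t = b⁻¹ s b.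
-- The southeast end of a ribbon, of content c, ends with a horizontal step c of τ and a
-- vertical step c of κ. Hence u⁻¹ c < 0 ≤ w⁻¹ c, so t swaps these two numbers.

open import Defs
open import Data.Bool.Base using (if_then_else_; true; false)
open import Data.Empty using (⊥-elim)
open import Data.Fin.Base as Fin using (Fin; toℕ; fromℕ<)
open import Data.Fin.Properties as Fin using (toℕ<n; toℕ-fromℕ<; any?)
open import Data.Integer.Base
  using (ℤ; +_; -[1+_]; +≤+; +<+; -≤+; -<+; 0ℤ; 1ℤ; -1ℤ; _+_; _*_; _-_; -_; ∣_∣; _≤_; _<_; _/ℕ_;
      _%ℕ_)
open import Data.Integer.DivMod using ([n/ℕd]*d≤n; n<s[n/ℕd]*d; a≡a%ℕn+[a/ℕn]*n; n%ℕd<d)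
open import Data.Integer.Divisibility.Signed
  using (_∣_; divides; _∣?_; ∣⇒∣ᵤ; ∣m∣n⇒∣m-n; ∣n⇒∣m*n; ∣-refl)
open import Data.Integer.Properties as ℤ using (pos-*)
open import Data.Integer.Solver using (module +-*-Solver)
open import Data.List.Base using (List; []; _∷_; _++_; length; reverse)
open import Data.List.Properties using (unfold-reverse)
open import Data.List.Relation.Binary.Pointwise using (Pointwise-≡⇒≡)
open import Data.List.Relation.Binary.Sublist.Heterogeneous.Properties
  using (length-mono-≤; toPointwise)
open import Data.List.Relation.Binary.Sublist.Propositional using ([]; _∷_; _∷ʳ_)
  renaming (_⊆_ to _⊑_; ⊆-refl to ⊑-refl; ⊆-trans to ⊑-trans)
open import Data.List.Relation.Unary.All using (All; []; _∷_)
open import Data.List.Relation.Unary.Linked using (Linked; []; [-]; _∷_)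
open import Data.Nat.Base as ℕ using (ℕ; zero; suc; _≥_; NonZero)
import Data.Nat.Divisibility as ℕ
open import Data.Nat.Induction using (<-wellFounded)
import Data.Nat.Properties as ℕ
open import Data.Product.Base using (Σ; ∃; ∃₂; _×_; _,_; proj₁; proj₂)
open import Data.Sum.Base as Sum using (_⊎_; inj₁; inj₂)
open import Function.Base using (_∘_)
open import Induction.WellFounded using (Acc; acc)
open import Relation.Binary.Construct.Closure.ReflexiveTransitive using (ε; _◅_)
open import Relation.Binary.Definitions using (tri<; tri≈; tri>)
open import Relation.Binary.PropositionalEquality
  using (_≡_; _≢_; _≗_; refl; sym; trans; cong; cong₂; subst; subst₂)
open import Relation.Nullary using (¬_; Dec; yes; no; does; ¬?; _×-dec_; _⊎-dec_)
open import Relation.Nullary.Decidable using (from-no; map′; dec-true; dec-false; decidable-stable)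
open import Relation.Unary using (_∈_; _∉_; _⊆_; _∖_)

open +-*-Solver using (solve; _:=_; _:+_; _:*_; _:-_; :-_; con)

-- The formula c + ⌊c/n⌋ + 1 is the value of φ at c: all permutations of the group fix the multiples
-- of n + 1, and φ skips one of them per n steps. A strong cover is defined by containment and
-- lengths alone, so its link to the subword order has to be established. Comparing integer
-- functions pointwise replaces the combinatorics of diagrams: the lifting property becomes an
-- inequality between sums of neighbouring values, settled by parity. A profile records only the
-- signs of w⁻¹, and right multiplication by s₁, ..., sₙ does not change them. So a subword with the
-- profile of τ represents merely some element of w Cₙ; it has to be brought to w itself by
-- deletions only, in order to remain a subword. The cover also brings its own Grassmannian
-- preimages of τ and κ, so the injectivity of 𝔞 is proved on the way.

≤-gap : ∀ {a b x y} → a ≤ b → b - a ≡ y - x → x ≤ y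
≤-gap {a} {b} {x} {y} a≤b eq =
  ℤ.i-j≤0⇒i≤j (subst (_≤ 0ℤ) flip-gap (ℤ.i≤j⇒i-j≤0 a≤b))
  where
  flip-gap : a - b ≡ x - y
  flip-gap = trans (solve 2 (λ a b → a :- b := :- (b :- a)) refl a b)
    (trans (cong -_ eq) (solve 2 (λ x y → :- (y :- x) := x :- y) refl x y))

-- Linear arithmetic by ring solving: a conclusion follows once its gap is written as a sum of the
-- gaps of known inequalities, and that identity is left to the solver.
≤-gap₂ : ∀ {a b c d x y} → a ≤ b → c ≤ d → (b - a) + (d - c) ≡ y - x → x ≤ y
≤-gap₂ {a} {b} {c} {d} a≤b c≤d eq =
  ≤-gap (ℤ.+-mono-≤ a≤b c≤d)
    (trans (solve 4 (λ a b c d → b :+ d :- (a :+ c) := (b :- a) :+ (d :- c)) refl a b c d) eq)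

<⇒+1≤ : ∀ {x y} → x < y → x + 1ℤ ≤ y
<⇒+1≤ {x} {y} x<y = subst (_≤ y) (ℤ.+-comm 1ℤ x) (ℤ.i<j⇒suc[i]≤j x<y)

+1≤⇒< : ∀ {x y} → x + 1ℤ ≤ y → x < y
+1≤⇒< {x} {y} x+1≤y = ℤ.suc[i]≤j⇒i<j (subst (_≤ y) (ℤ.+-comm x 1ℤ) x+1≤y)

+1-1 : ∀ k → k + 1ℤ - 1ℤ ≡ k
+1-1 = solve 1 (λ k → k :+ con 1ℤ :- con 1ℤ := k) refl

-1+1 : ∀ k → k - 1ℤ + 1ℤ ≡ k
-1+1 = solve 1 (λ k → k :- con 1ℤ :+ con 1ℤ := k) refl

k-1<k : ∀ k → k - 1ℤ < k
k-1<k k = +1≤⇒< (ℤ.≤-reflexive (-1+1 k))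

-- Congruences with an explicit quotient

infix 4 _≅_⟨_⟩

-- Unlike x ≡ y [mod m ], which unfolds to a statement about x - y, this determines x and y.
data _≅_⟨_⟩ (x y : ℤ) (m : ℕ) : Set where
  by : ∀ q → x ≡ y + q * + m → x ≅ y ⟨ m ⟩

module _ {m : ℕ} where

  fromMod : ∀ {x y} → x ≡ y [mod m ] → x ≅ y ⟨ m ⟩
  fromMod {x} {y} (divides q eq) =
    by q (trans (solve 2 (λ x y → x := y :+ (x :- y)) refl x y) (cong (_+_ y) eq))

  toMod : ∀ {x y} → x ≅ y ⟨ m ⟩ → x ≡ y [mod m ]
  toMod {x} {y} (by q refl) = divides q (solve 2 (λ y d → y :+ d :- y := d) refl y (q * + m))

  ≅-reflexive : ∀ {x y} → x ≡ y → x ≅ y ⟨ m ⟩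
  ≅-reflexive {x} refl = by 0ℤ (sym (ℤ.+-identityʳ x))

  ≅-sym : ∀ {x y} → x ≅ y ⟨ m ⟩ → y ≅ x ⟨ m ⟩
  ≅-sym {x} {y} (by q refl) =
    by (- q) (solve 3 (λ y q m → y := y :+ q :* m :+ (:- q) :* m) refl y q (+ m))

  ≅-trans : ∀ {x y z} → x ≅ y ⟨ m ⟩ → y ≅ z ⟨ m ⟩ → x ≅ z ⟨ m ⟩
  ≅-trans {z = z} (by q refl) (by r refl) =
    by (r + q) (solve 4 (λ z q r m → z :+ r :* m :+ q :* m := z :+ (r :+ q) :* m) refl z q r (+ m))

  ≅-+ : ∀ {x y} d → x ≅ y ⟨ m ⟩ → x + d ≅ y + d ⟨ m ⟩
  ≅-+ {y = y} d (by q refl) =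
    by q (solve 3 (λ y d q → y :+ q :+ d := y :+ d :+ q) refl y d (q * + m))

  ≅-neg : ∀ {x y} → x ≅ y ⟨ m ⟩ → - x ≅ - y ⟨ m ⟩
  ≅-neg {y = y} (by q refl) =
    by (- q) (solve 3 (λ y q m → :- (y :+ q :* m) := :- y :+ (:- q) :* m) refl y q (+ m))

  ≅-flip : ∀ {x y} → x ≅ - y ⟨ m ⟩ → - x ≅ y ⟨ m ⟩
  ≅-flip {y = y} p = ≅-trans (≅-neg p) (≅-reflexive (ℤ.neg-involutive y))

-- The letters as permutations of the boundary steps

-- The diagonals k around which sᵢ swaps the boundary steps k - 1 and k.
data Hit {n} (i : Fin (suc n)) (k : ℤ) : Set where
  hit⁺ : k ≅ + toℕ i ⟨ 2 ℕ.* n ⟩ → Hit i k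
  hit⁻ : k ≅ - + toℕ i ⟨ 2 ℕ.* n ⟩ → Hit i k

opaque
  hit? : ∀ {n} (i : Fin (suc n)) k → Dec (Hit i k)
  hit? {n} i k = map′
    Sum.[ hit⁺ ∘ fromMod , hit⁻ ∘ fromMod ]
    (λ { (hit⁺ p) → inj₁ (toMod p) ; (hit⁻ p) → inj₂ (toMod p) })
    (congruent? (2 ℕ.* n) k (+ toℕ i) ⊎-dec congruent? (2 ℕ.* n) k (- + toℕ i))

-- The order of the two tests is immaterial: by `hit-exclusive` consecutive diagonals are never both
-- hit, so the swaps do not overlap.
σ : ∀ {n} → Fin (suc n) → ℤ → ℤ
σ i k = if does (hit? i (k + 1ℤ)) then k + 1ℤ else if does (hit? i k) then k - 1ℤ else k

-- Transposing a diagram reverses its boundary, exchanging the steps k and - 1 - k.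
mirror : ℤ → ℤ
mirror k = -1ℤ - k

module _ {n : ℕ} where

  infixl 6 _⊕_
  _⊕_ : ℤ → ℤ → ℤ
  k ⊕ q = k + q * + (2 ℕ.* n)

  ⊕-+ : ∀ k q d → (k + d) ⊕ q ≡ (k ⊕ q) + d
  ⊕-+ k q d = solve 3 (λ k m d → k :+ d :+ m := k :+ m :+ d) refl k (q * + (2 ℕ.* n)) d

  module _ (i : Fin (suc n)) where

    hit-≅ : ∀ {k l} → k ≅ l ⟨ 2 ℕ.* n ⟩ → Hit i k → Hit i l
    hit-≅ k≅l (hit⁺ p) = hit⁺ (≅-trans (≅-sym k≅l) p)
    hit-≅ k≅l (hit⁻ p) = hit⁻ (≅-trans (≅-sym k≅l) p)

    hit-neg : ∀ {k} → Hit i k → Hit i (- k)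
    hit-neg (hit⁺ p) = hit⁻ (≅-neg p)
    hit-neg (hit⁻ p) = hit⁺ (≅-flip p)

    hit-unique : ∀ {k l} → Hit i k → Hit i l → k ≅ l ⟨ 2 ℕ.* n ⟩ ⊎ k ≅ - l ⟨ 2 ℕ.* n ⟩
    hit-unique (hit⁺ p) (hit⁺ q) = inj₁ (≅-trans p (≅-sym q))
    hit-unique (hit⁻ p) (hit⁻ q) = inj₁ (≅-trans p (≅-sym q))
    hit-unique (hit⁻ p) (hit⁺ q) = inj₂ (≅-trans p (≅-neg (≅-sym q)))
    hit-unique (hit⁺ p) (hit⁻ q) = inj₂ (≅-trans p (≅-sym (≅-flip q)))

    -- ± i ≡ i modulo 2, so consecutive diagonals are not both hit.
    hit-parity : ∀ {k} → Hit i k → + 2 ∣ k - + toℕ i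
    hit-parity (hit⁺ (by q refl)) = divides (q * + n)
      (trans (cong (λ m → + toℕ i + q * m - + toℕ i) (pos-* 2 n))
        (solve 3 (λ q n i → i :+ q :* (con (+ 2) :* n) :- i := q :* n :* con (+ 2)) refl
          q (+ n) (+ toℕ i)))
    hit-parity (hit⁻ (by q refl)) = divides (q * + n - + toℕ i)
      (trans (cong (λ m → - + toℕ i + q * m - + toℕ i) (pos-* 2 n))
        (solve 3 (λ q n i → :- i :+ q :* (con (+ 2) :* n) :- i := (q :* n :- i) :* con (+ 2)) refl
          q (+ n) (+ toℕ i)))

    hit-exclusive : ∀ {k} → Hit i k → ¬ Hit i (k + 1ℤ)
    hit-exclusive {k} h h′ = from-no (+ 2 ∣? 1ℤ)
      (subst (+ 2 ∣_) (solve 2 (λ k i → (k :+ con 1ℤ :- i) :- (k :- i) := con 1ℤ) refl k (+ toℕ i))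
        (∣m∣n⇒∣m-n (hit-parity h′) (hit-parity h)))

    σ-up : ∀ {k} → Hit i (k + 1ℤ) → σ i k ≡ k + 1ℤ
    σ-up {k} h rewrite dec-true (hit? i (k + 1ℤ)) h = refl

    σ-down : ∀ {k} → Hit i k → σ i k ≡ k - 1ℤ
    σ-down {k} h rewrite dec-false (hit? i (k + 1ℤ)) (hit-exclusive h) | dec-true
        (hit? i k) h = refl

    σ-fix : ∀ {k} → ¬ Hit i (k + 1ℤ) → ¬ Hit i k → σ i k ≡ k
    σ-fix {k} h h′ rewrite dec-false (hit? i (k + 1ℤ)) h | dec-false (hit? i k) h′ = refl

    data View (k : ℤ) : Set where
      up   : Hit i (k + 1ℤ) → View k
      down : Hit i k → View k
      fix  : ¬ Hit i (k + 1ℤ) → ¬ Hit i k → View k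

    view : ∀ k → View k
    view k with hit? i (k + 1ℤ) | hit? i k
    ... | yes h | _      = up h
    ... | no _  | yes h  = down h
    ... | no h  | no h′  = fix h h′

    σ-⊕ : ∀ k q → σ i (k ⊕ q) ≡ σ i k ⊕ q
    σ-⊕ k q with view k
    ... | up h = trans (σ-up (subst (Hit i) (⊕-+ k q 1ℤ) (hit-≅ (≅-sym (by q refl)) h)))
                   (sym (trans (cong (_⊕ q) (σ-up h)) (⊕-+ k q 1ℤ)))
    ... | down h = trans (σ-down (hit-≅ (≅-sym (by q refl)) h))
                   (sym (trans (cong (_⊕ q) (σ-down h)) (⊕-+ k q (- 1ℤ))))
    ... | fix h h′ = trans
      (σ-fix (λ g → h (hit-≅ (≅-+ {y = k} 1ℤ (by q refl)) g)) (λ g → h′ (hit-≅ (by q refl) g)))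
      (cong (_⊕ q) (sym (σ-fix h h′)))

    -- The mirror carries the steps around the diagonal k to those around -k, and `Hit i` is closed
    -- under negation; moves up and down trade places.
    σ-neg : ∀ k → σ i (mirror k) ≡ mirror (σ i k)
    σ-neg k with view k
    ... | up h = trans (σ-down (subst (Hit i) (e k) (hit-neg h)))
                   (trans (e′ k) (cong mirror (sym (σ-up h))))
      where
      e : ∀ k → - (k + 1ℤ) ≡ -1ℤ - k
      e = solve 1 (λ k → :- (k :+ con 1ℤ) := con -1ℤ :- k) refl
      e′ : ∀ k → -1ℤ - k - 1ℤ ≡ -1ℤ - (k + 1ℤ)
      e′ = solve 1 (λ k → con -1ℤ :- k :- con 1ℤ := con -1ℤ :- (k :+ con 1ℤ)) refl
    ... | down h = trans (σ-up (subst (Hit i) (e k) (hit-neg h)))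
                   (trans (e′ k) (cong mirror (sym (σ-down h))))
      where
      e : ∀ k → - k ≡ -1ℤ - k + 1ℤ
      e = solve 1 (λ k → :- k := con -1ℤ :- k :+ con 1ℤ) refl
      e′ : ∀ k → -1ℤ - k + 1ℤ ≡ -1ℤ - (k - 1ℤ)
      e′ = solve 1 (λ k → con -1ℤ :- k :+ con 1ℤ := con -1ℤ :- (k :- con 1ℤ)) refl
    ... | fix h h′ = trans
      (σ-fix (λ g → h′ (subst (Hit i) (e k) (hit-neg g)))
          (λ g → h (subst (Hit i) (e′ k) (hit-neg g))))
      (cong mirror (sym (σ-fix h h′)))
      where
      e : ∀ k → - (-1ℤ - k + 1ℤ) ≡ k
      e = solve 1 (λ k → :- (con -1ℤ :- k :+ con 1ℤ) := k) refl
      e′ : ∀ k → - (-1ℤ - k) ≡ k + 1ℤ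
      e′ = solve 1 (λ k → :- (con -1ℤ :- k) := k :+ con 1ℤ) refl

    σ-involutive : ∀ k → σ i (σ i k) ≡ k
    σ-involutive k with view k
    ... | up h = trans (cong (σ i) (σ-up h)) (trans (σ-down h) (+1-1 k))
    ... | down h = trans (cong (σ i) (σ-down h))
                     (trans (σ-up (subst (Hit i) (sym (-1+1 k)) h)) (-1+1 k))
    ... | fix h h′ = trans (cong (σ i) (σ-fix h h′)) (σ-fix h h′)

-- The numbering φ of the integers not divisible by n + 1

module _ (n : ℕ) .{{_ : NonZero n}} where

  /ℕ-quotient-≤ : ∀ {k l q} → k ≤ l → q * + n ≤ k → q ≤ l /ℕ n
  /ℕ-quotient-≤ {k} {l} {q} k≤l qn≤k = ℤ.≮⇒≥ λ q> →
    ℤ.<-irrefl refl (ℤ.<-≤-trans (n<s[n/ℕd]*d l n)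
      (ℤ.≤-trans (ℤ.*-monoʳ-≤-nonNeg (+ n) (ℤ.i<j⇒suc[i]≤j q>)) (ℤ.≤-trans qn≤k k≤l)))

  /ℕ-unique : ∀ {k} q r → r ℕ.< n → k ≡ + r + q * + n → k /ℕ n ≡ q
  /ℕ-unique q r r<n refl = ℤ.≤-antisym
    (ℤ.≮⇒≥ λ q< → ℤ.<-irrefl refl (ℤ.<-≤-trans
      (ℤ.+-monoˡ-< (q * + n) (+<+ r<n))
      (ℤ.≤-trans (ℤ.≤-reflexive (solve 2 (λ n q → n :+ q :* n := (con 1ℤ :+ q) :* n) refl (+ n) q))
        (ℤ.≤-trans (ℤ.*-monoʳ-≤-nonNeg (+ n) (ℤ.i<j⇒suc[i]≤j q<)) ([n/ℕd]*d≤n _ n)))))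
    (/ℕ-quotient-≤ ℤ.≤-refl (ℤ.i≤j+i (q * + n) (+ r)))

  /ℕ-mono : ∀ {k l} → k ≤ l → k /ℕ n ≤ l /ℕ n
  /ℕ-mono {k} k≤l = /ℕ-quotient-≤ k≤l ([n/ℕd]*d≤n k n)

  -- The increasing bijection from ℤ onto the integers that are not divisible by n + 1.
  opaque
    φ : ℤ → ℤ
    φ k = k + (k /ℕ n) + 1ℤ

    φ-def : ∀ k → φ k ≡ k + (k /ℕ n) + 1ℤ
    φ-def k = refl

    φ-value : ∀ q r → r ℕ.< n → φ (+ r + q * + n) ≡ + r + q * + n + q + 1ℤ
    φ-value q r r<n = cong (λ p → + r + q * + n + p + 1ℤ) (/ℕ-unique q r r<n refl)

    φ-mono-< : ∀ {k l} → k < l → φ k < φ l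
    φ-mono-< {k} {l} k<l = ℤ.+-monoˡ-< 1ℤ (ℤ.+-mono-<-≤ k<l (/ℕ-mono (ℤ.<⇒≤ k<l)))

  φ-injective : ∀ {k l} → φ k ≡ φ l → k ≡ l
  φ-injective {k} {l} eq with ℤ.<-cmp k l
  ... | tri< k<l _ _ = ⊥-elim (ℤ.<-irrefl eq (φ-mono-< k<l))
  ... | tri≈ _ k≡l _ = k≡l
  ... | tri> _ _ k>l = ⊥-elim (ℤ.<-irrefl (sym eq) (φ-mono-< k>l))

  +period : ∀ q → q * + period n ≡ q * (+ 2 * + n + + 2)
  +period q = cong (q *_) (trans (ℤ.pos-+ (2 ℕ.* n) 2) (cong (_+ + 2) (pos-* 2 n)))

  opaque
    unfolding φ

    -- Adding 2n raises the quotient by n by 2, so φ grows by 2n + 2: the period of the steps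
    -- becomes the period of the group.
    φ-⊕ : ∀ k q → φ (k + q * + (2 ℕ.* n)) ≡ φ k + q * + period n
    φ-⊕ k q = trans
      (cong (λ p → k + q * + (2 ℕ.* n) + p + 1ℤ)
          (/ℕ-unique (k /ℕ n + q * + 2) (k %ℕ n) (n%ℕd<d k n) eq))
      (trans (cong (λ m → k + q * m + (k /ℕ n + q * + 2) + 1ℤ) (pos-* 2 n))
      (trans (solve 4 (λ k p q n → k :+ q :* (con (+ 2) :* n) :+ (p :+ q :* con (+ 2)) :+ con 1ℤ
                         := (k :+ p :+ con 1ℤ) :+ q :* (con (+ 2) :* n :+ con (+ 2))) refl
                     k (k /ℕ n) q (+ n))
             (cong (_+_ (φ k)) (sym (+period q)))))
      where
      eq : k + q * + (2 ℕ.* n) ≡ + (k %ℕ n) + (k /ℕ n + q * + 2) * + n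
      eq = trans (cong₂ (λ x m → x + q * m) (a≡a%ℕn+[a/ℕn]*n k n) (pos-* 2 n))
        (solve 4 (λ r p q n → r :+ p :* n :+ q :* (con (+ 2) :* n) := r :+
            (p :+ q :* con (+ 2)) :* n)
          refl (+ (k %ℕ n)) (k /ℕ n) q (+ n))

    -- For k = r + p n, the mirror -1 - k has remainder n - 1 - r and quotient -1 - p.
    φ-mirror : ∀ k → φ (mirror k) ≡ - φ k
    φ-mirror k = trans
      (cong (λ p → mirror k + p + 1ℤ) (/ℕ-unique (mirror (k /ℕ n)) (n ℕ.∸ suc (k %ℕ n)) r<n eq))
      (solve 2 (λ k p → con -1ℤ :- k :+ (con -1ℤ :- p) :+ con 1ℤ := :- (k :+ p :+ con 1ℤ)) refl k
          (k /ℕ n))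
      where
      r<n : n ℕ.∸ suc (k %ℕ n) ℕ.< n
      r<n = ℕ.∸-monoʳ-< (ℕ.s≤s ℕ.z≤n) (n%ℕd<d k n)
      +-r : + (n ℕ.∸ suc (k %ℕ n)) ≡ + n - + suc (k %ℕ n)
      +-r = trans (sym (ℤ.⊖-≥ (n%ℕd<d k n))) (sym (ℤ.m-n≡m⊖n n (suc (k %ℕ n))))
      eq : mirror k ≡ + (n ℕ.∸ suc (k %ℕ n)) + mirror (k /ℕ n) * + n
      eq = trans (cong mirror (a≡a%ℕn+[a/ℕn]*n k n))
        (trans (solve 3 (λ r p n → con -1ℤ :- (r :+ p :* n)
                           := n :- (con 1ℤ :+ r) :+ (con -1ℤ :- p) :* n) refl (+ (k %ℕ n)) (k /ℕ n)
                               (+ n))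
          (cong (_+ mirror (k /ℕ n) * + n) (sym +-r)))

    -- With r the remainder of k modulo n, φ k is congruent to r + 1 modulo n + 1, and 1 ≤ r + 1 ≤
    -- n.
    φ-nonmultiple : ∀ k → φ k ≢ 0ℤ [mod suc n ]
    φ-nonmultiple k d = ℕ.<⇒≱ (n%ℕd<d k n) (ℕ.s≤s⁻¹ (ℕ.∣⇒≤ (∣⇒∣ᵤ
      (subst (+ suc n ∣_) eq (∣m∣n⇒∣m-n d (∣n⇒∣m*n (k /ℕ n) ∣-refl))))))
      where
      eq : φ k - 0ℤ - (k /ℕ n) * + suc n ≡ + suc (k %ℕ n)
      eq = trans (cong (λ x → x + k /ℕ n + 1ℤ - 0ℤ - (k /ℕ n) * + suc n) (a≡a%ℕn+[a/ℕn]*n k n))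
        (solve 3 (λ r p n → r :+ p :* n :+ p :+ con 1ℤ :- con 0ℤ :- p :*
            (con 1ℤ :+ n) := con 1ℤ :+ r) refl
          (+ (k %ℕ n)) (k /ℕ n) (+ n))

  φ-≅ : ∀ {k l} → k ≅ l ⟨ 2 ℕ.* n ⟩ → φ k ≅ φ l ⟨ period n ⟩
  φ-≅ {l = l} (by q refl) = by q (φ-⊕ l q)

  φ-≅⁻¹ : ∀ {k l} → φ k ≅ φ l ⟨ period n ⟩ → k ≅ l ⟨ 2 ℕ.* n ⟩
  φ-≅⁻¹ {l = l} (by q eq) = by q (φ-injective (trans eq (sym (φ-⊕ l q))))

  data Position : ℤ → Set where
    multiple : ∀ {x} → x ≅ 0ℤ ⟨ suc n ⟩ → Position x
    value    : ∀ k → Position (φ k)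

  -- Division by n + 1 decides: remainder 0 gives a multiple, while remainder r + 1 with quotient q
  -- gives the value of φ at r + q n.
  position : ∀ x → Position x
  position x with x %ℕ suc n in eq | a≡a%ℕn+[a/ℕn]*n x (suc n) | n%ℕd<d x (suc n)
  ... | 0     | x≡ | _ = multiple (by (x /ℕ suc n) x≡)
  ... | suc r | x≡ | ℕ.s≤s r<n = subst Position
    (trans (φ-value (x /ℕ suc n) r r<n) (trans
      (solve 3 (λ r p n → r :+ p :* n :+ p :+ con 1ℤ := con 1ℤ :+ r :+ p :* (con 1ℤ :+ n)) refl
        (+ r) (x /ℕ suc n) (+ n)) (sym x≡)))
    (value (+ r + (x /ℕ suc n) * + n))

  φ-+ : ∀ r → r ℕ.< n → φ (+ r) ≡ + suc r
  φ-+ r r<n = trans (cong φ (sym (ℤ.+-identityʳ (+ r)))) (trans (φ-value 0ℤ r r<n)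
    (solve 1 (λ r → r :+ con 0ℤ :+ con 0ℤ :+ con 1ℤ := con 1ℤ :+ r) refl (+ r)))

  φ-n : φ (+ n) ≡ + (n ℕ.+ 2)
  φ-n = trans (cong φ (solve 1 (λ n → n := con 0ℤ :+ con 1ℤ :* n) refl (+ n)))
    (trans (φ-value 1ℤ 0 (ℕ.>-nonZero⁻¹ n))
      (trans (solve 1 (λ n → con 0ℤ :+ con 1ℤ :* n :+ con 1ℤ :+ con 1ℤ := n :+ con (+ 2)) refl
          (+ n))
             (sym (ℤ.pos-+ n 2))))

-- The generators act as the letters σ

module _ {n : ℕ} .{{_ : NonZero n}} where

  multiple-≢-φ : ∀ {x} l → x ≅ 0ℤ ⟨ suc n ⟩ → ¬ x ≅ φ n l ⟨ period n ⟩
  multiple-≢-φ {x} l x≅0 p = φ-nonmultiple n l (toMod (≅-trans (≅-sym (coarsen p)) x≅0))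
    where
    coarsen : ∀ {y z} → y ≅ z ⟨ period n ⟩ → y ≅ z ⟨ suc n ⟩
    coarsen {z = z} (by q eq) = by (q * + 2) (trans eq (cong (_+_ z) (trans (+period n q)
      (solve 2 (λ q n → q :* (con (+ 2) :* n :+ con (+ 2)) := q :* con (+ 2) :* (con 1ℤ :+ n))
        refl q (+ n)))))

  module Letter (i : Fin (suc n)) where

    record Realizes (s : ℤ → ℤ) : Set where
      field
        on-values    : ∀ k → s (φ n k) ≡ φ n (σ i k)
        on-multiples : ∀ {x} → x ≅ 0ℤ ⟨ suc n ⟩ → s x ≡ x

    hit-+1 : ∀ {k l} → k ≅ l ⟨ 2 ℕ.* n ⟩ → Hit i (l + 1ℤ) → Hit i (k + 1ℤ)
    hit-+1 p = hit-≅ i (≅-sym (≅-+ 1ℤ p))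

    -- A common frame for the three shapes of generators: `A` marks the lower and `B` the upper
    -- number of a swapped pair, and `d` is the jump of φ across the diagonal i. Periodicity and the
    -- mirror give the same jump at every diagonal congruent to ±i.
    realizes : ∀ d {A B : ℤ → Set} (A? : ∀ x → Dec (A x)) (B? : ∀ x → Dec (B x)) →
      (∀ {x} → A x → ∃ λ l → x ≅ φ n l ⟨ period n ⟩ × Hit i (l + 1ℤ)) →
      (∀ k → Hit i (k + 1ℤ) → A (φ n k)) →
      (∀ {x} → B x → ∃ λ l → x ≅ φ n l ⟨ period n ⟩ × Hit i l) →
      (∀ k → Hit i k → B (φ n k)) →
      φ n (+ toℕ i - 1ℤ) + d ≡ φ n (+ toℕ i) →
      Realizes (λ x → if does (A? x) then x + d else if does (B? x) then x - d else x)
    realizes d {A} {B} A? B? A⇒ ⇒A B⇒ ⇒B gap = record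
      { on-values = values ; on-multiples = multiples }
      where
      gap-⊕ : ∀ {k} l → φ n l + d ≡ φ n (l + 1ℤ) → k ≅ l ⟨ 2 ℕ.* n ⟩ → φ n k + d ≡ φ n (k + 1ℤ)
      gap-⊕ l eq (by q refl) = trans (cong (_+ d) (φ-⊕ n l q)) (trans
        (solve 3 (λ x y d → x :+ y :+ d := x :+ d :+ y) refl (φ n l) (q * + period n) d)
        (trans (cong (_+ q * + period n) eq)
        (trans (sym (φ-⊕ n (l + 1ℤ) q)) (cong (φ n) (⊕-+ {n} l q 1ℤ)))))

      gap-hit : ∀ k → Hit i (k + 1ℤ) → φ n k + d ≡ φ n (k + 1ℤ)
      gap-hit k (hit⁺ p) = gap-⊕ (+ toℕ i - 1ℤ) (trans gap (cong (φ n) (sym (-1+1 (+ toℕ i)))))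
        (subst (_≅ _ ⟨ _ ⟩) (+1-1 k) (≅-+ (- 1ℤ) p))
      -- The steps around -i are the mirrors of those around i in reverse order, so the jump there
      -- is the one at i.
      gap-hit k (hit⁻ p) = gap-⊕ (- + toℕ i - 1ℤ)
          (trans (cong (_+ d) (trans (cong (φ n) (e (+ toℕ i))) (φ-mirror n (+ toℕ i))))
        (trans (subst (λ x → - x + d ≡ - φ n (+ toℕ i - 1ℤ)) gap
                  (solve 2 (λ x d → :- (x :+ d) :+ d := :- x) refl (φ n (+ toℕ i - 1ℤ)) d))
          (trans (sym (φ-mirror n (+ toℕ i - 1ℤ))) (cong (φ n) (e′ (+ toℕ i))))))
        (subst (_≅ _ ⟨ _ ⟩) (+1-1 k) (≅-+ (- 1ℤ) p))
        where
        e : ∀ j → - j - 1ℤ ≡ mirror j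
        e = solve 1 (λ j → :- j :- con 1ℤ := con -1ℤ :- j) refl
        e′ : ∀ j → mirror (j - 1ℤ) ≡ - j - 1ℤ + 1ℤ
        e′ = solve 1 (λ j → con -1ℤ :- (j :- con 1ℤ) := :- j :- con 1ℤ :+ con 1ℤ) refl

      values : ∀ k → (if does (A? (φ n k)) then φ n k + d
                      else if does (B? (φ n k)) then φ n k - d else φ n k) ≡ φ n (σ i k)
      values k with A? (φ n k) | B? (φ n k)
      ... | yes a | _     = let l , p , h = A⇒ a ; h′ = hit-+1 (φ-≅⁻¹ n p) h in
                            trans (gap-hit k h′) (cong (φ n) (sym (σ-up i h′)))
      ... | no _  | yes b = let l , p , h = B⇒ b ; h′ = hit-≅ i (≅-sym (φ-≅⁻¹ n p)) h in
        trans (trans (cong (_- d)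
            (trans (cong (φ n) (sym (-1+1 k)))
            (sym (gap-hit (k - 1ℤ) (subst (Hit i) (sym (-1+1 k)) h′)))))
                (solve 2 (λ x d → x :+ d :- d := x) refl (φ n (k - 1ℤ)) d))
          (cong (φ n) (sym (σ-down i h′)))
      ... | no ¬a | no ¬b = cong (φ n) (sym (σ-fix i (¬a ∘ ⇒A k) (¬b ∘ ⇒B k)))

      multiples : ∀ {x} → x ≅ 0ℤ ⟨ suc n ⟩ →
        (if does (A? x) then x + d else if does (B? x) then x - d else x) ≡ x
      multiples {x} x≅0 with A? x | B? x
      ... | yes a | _     = let l , p , _ = A⇒ a in ⊥-elim (multiple-≢-φ l x≅0 p)
      ... | no _  | yes b = let l , p , _ = B⇒ b in ⊥-elim (multiple-≢-φ l x≅0 p)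
      ... | no _  | no _  = refl

    toφ : ∀ {x y} l → φ n l ≡ y → x ≡ y [mod period n ] → x ≅ φ n l ⟨ period n ⟩
    toφ l refl p = fromMod p

    fromφ : ∀ {k l y} → φ n l ≡ y → k ≅ l ⟨ 2 ℕ.* n ⟩ → φ n k ≡ y [mod period n ]
    fromφ refl p = toMod (φ-≅ n p)

    lower : ∀ k {l} → k + 1ℤ ≅ l ⟨ 2 ℕ.* n ⟩ → k ≅ l - 1ℤ ⟨ 2 ℕ.* n ⟩
    lower k p = subst (_≅ _ ⟨ _ ⟩) (+1-1 k) (≅-+ (- 1ℤ) p)

    φ-mirror-+ : ∀ r → r ℕ.< n → φ n (mirror (+ r)) ≡ - + suc r
    φ-mirror-+ r r<n = trans (φ-mirror n (+ r)) (cong -_ (φ-+ n r r<n))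

    s₀-realizes : toℕ i ≡ 0 → Realizes (s₀ n)
    s₀-realizes i≡0 = realizes (+ 2)
      (λ x → congruent? (period n) x (- + 1)) (λ x → congruent? (period n) x (+ 1))
      (λ {x} p → -1ℤ , toφ {x} -1ℤ φ[-1] p , hit⁺ (≅-reflexive (sym +i≡0)))
      (λ k h → fromφ φ[-1] (lower k (hit₀ h)))
      (λ {x} p → 0ℤ , toφ {x} 0ℤ φ0 p , hit⁺ (≅-reflexive (sym +i≡0)))
      (λ k h → fromφ φ0 (hit₀ h))
      (subst (λ j → φ n (j - 1ℤ) + + 2 ≡ φ n j) (sym +i≡0) (trans (cong (_+ + 2) φ[-1]) (sym φ0)))
      where
      +i≡0 : + toℕ i ≡ 0ℤ
      +i≡0 = cong +_ i≡0
      φ0 : φ n 0ℤ ≡ + 1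
      φ0 = φ-+ n 0 (ℕ.>-nonZero⁻¹ n)
      φ[-1] : φ n -1ℤ ≡ -1ℤ
      φ[-1] = φ-mirror-+ 0 (ℕ.>-nonZero⁻¹ n)
      hit₀ : ∀ {k} → Hit i k → k ≅ 0ℤ ⟨ 2 ℕ.* n ⟩
      hit₀ (hit⁺ p) = ≅-trans p (≅-reflexive +i≡0)
      hit₀ (hit⁻ p) = ≅-trans p (≅-reflexive (cong -_ +i≡0))

    -- The jump is 2 because φ passes over n + 1 between the steps n - 1 and n. In `Hit`, both signs
    -- give the same class, since n and -n differ by 2n.
    sₙ-realizes : toℕ i ≡ n → Realizes (sₙ n)
    sₙ-realizes i≡n = realizes (+ 2)
      (λ x → congruent? (period n) x (+ n)) (λ x → congruent? (period n) x (+ (n ℕ.+ 2)))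
      (λ {x} p → + n - 1ℤ , toφ {x} (+ n - 1ℤ) φ[n-1] p , hit⁺
          (≅-reflexive (trans (-1+1 (+ n)) (sym +i≡n))))
      (λ k h → fromφ φ[n-1] (lower k (hitₙ h)))
      (λ {x} p → + n , toφ {x} (+ n) (φ-n n) p , hit⁺ (≅-reflexive (sym +i≡n)))
      (λ k h → fromφ (φ-n n) (hitₙ h))
      (subst (λ j → φ n (j - 1ℤ) + + 2 ≡ φ n j) (sym +i≡n) (trans (cong (_+ + 2) φ[n-1])
        (trans (sym (ℤ.pos-+ n 2)) (sym (φ-n n)))))
      where
      +i≡n : + toℕ i ≡ + n
      +i≡n = cong +_ i≡n
      φ[n-1] : φ n (+ n - 1ℤ) ≡ + n
      φ[n-1] = trans (cong (φ n) (trans (ℤ.m-n≡m⊖n n 1) (ℤ.⊖-≥ (ℕ.>-nonZero⁻¹ n))))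
        (trans (φ-+ n (n ℕ.∸ 1) (ℕ.∸-monoʳ-< (ℕ.s≤s ℕ.z≤n) (ℕ.>-nonZero⁻¹ n)))
               (cong +_ (ℕ.m+[n∸m]≡n (ℕ.>-nonZero⁻¹ n))))
      hitₙ : ∀ {k} → Hit i k → k ≅ + n ⟨ 2 ℕ.* n ⟩
      hitₙ (hit⁺ p) = ≅-trans p (≅-reflexive +i≡n)
      hitₙ (hit⁻ p) = ≅-trans p (by -1ℤ (trans (cong -_ +i≡n)
        (trans (solve 1 (λ n → :- n := n :+ con -1ℤ :* (con (+ 2) :* n)) refl (+ n))
          (cong (λ m → + n + -1ℤ * m) (sym (pos-* 2 n))))))

    -- For 0 < i < n the steps i - 1 and i lie in one block of consecutive values of φ, whence the
    -- jump 1. The two alternatives in each test are the two signs in `Hit`.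
    sᵢ-realizes : ∀ p → toℕ i ≡ suc p → suc p ℕ.< n → Realizes (sᵢ n (suc p))
    sᵢ-realizes p i≡p+1 p+1<n = realizes (+ 1)
      (λ x → congruent? (period n) x (+ suc p) ⊎-dec congruent? (period n) x (- (+ suc p) - + 1))
      (λ x → congruent? (period n) x (+ (suc p ℕ.+ 1)) ⊎-dec congruent? (period n) x (- (+ suc p)))
      (λ { {x} (inj₁ c) → + p , toφ {x} (+ p) φp c , hit⁺
          (≅-reflexive (trans (ℤ.+-comm (+ p) 1ℤ) (sym +i≡)))
         ; {x} (inj₂ c) → mirror (+ suc p) , toφ {x} (mirror (+ suc p)) φmp+1 c ,
                      hit⁻ (≅-reflexive (trans (e (+ suc p)) (cong -_ (sym +i≡)))) })
      (λ { k (hit⁺ h) → inj₁ (fromφ φp ((lower k (≅-trans h (≅-reflexive +i≡)))))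
         ; k (hit⁻ h) → inj₂ (fromφ φmp+1
             ((≅-trans (lower k (≅-trans h (≅-reflexive (cong -_ +i≡))))
                              (≅-reflexive (e′ (+ suc p)))))) })
      (λ { {x} (inj₁ c) → + suc p , toφ {x} (+ suc p) φp+1 c , hit⁺ (≅-reflexive (sym +i≡))
         ; {x} (inj₂ c) → mirror (+ p) , toφ {x} (mirror (+ p)) φmp c ,
                      hit⁻ (≅-reflexive (trans (e″ (+ p)) (cong -_ (sym +i≡)))) })
      (λ { k (hit⁺ h) → inj₁ (fromφ φp+1 ((≅-trans h (≅-reflexive +i≡))))
         ; k (hit⁻ h) → inj₂ (fromφ φmp ((≅-trans h
                              (≅-reflexive (trans (cong -_ +i≡) (sym (e″ (+ p)))))))) })
      (subst (λ j → φ n (j - 1ℤ) + + 1 ≡ φ n j) (sym +i≡) (trans (cong (_+ + 1) φp)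
        (sym φp+1)))
      where
      p<n : p ℕ.< n
      p<n = ℕ.<-trans (ℕ.n<1+n p) p+1<n
      +i≡ : + toℕ i ≡ + suc p
      +i≡ = cong +_ i≡p+1
      φp : φ n (+ p) ≡ + suc p
      φp = φ-+ n p p<n
      φmp : φ n (mirror (+ p)) ≡ - + suc p
      φmp = φ-mirror-+ p p<n
      φp+1 : φ n (+ suc p) ≡ + (suc p ℕ.+ 1)
      φp+1 = trans (φ-+ n (suc p) p+1<n) (cong +_ (ℕ.+-comm 1 (suc p)))
      φmp+1 : φ n (mirror (+ suc p)) ≡ - (+ suc p) - + 1
      φmp+1 = trans (φ-mirror-+ (suc p) p+1<n)
        (solve 1 (λ p → :- (con 1ℤ :+ p) := :- p :- con 1ℤ) refl (+ suc p))
      e : ∀ j → mirror j + 1ℤ ≡ - j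
      e = solve 1 (λ j → con -1ℤ :- j :+ con 1ℤ := :- j) refl
      e′ : ∀ j → - j - 1ℤ ≡ mirror j
      e′ = solve 1 (λ j → :- j :- con 1ℤ := con -1ℤ :- j) refl
      e″ : ∀ j → mirror j ≡ - (1ℤ + j)
      e″ = solve 1 (λ j → con -1ℤ :- j := :- (con 1ℤ :+ j)) refl

    gen-realizes : Realizes (gen n i)
    gen-realizes with toℕ i ℕ.≟ 0 | toℕ i ℕ.≟ n
    ... | yes i≡0 | _ = subst Realizes
      (cong (λ b → if b then s₀ n else if does (toℕ i ℕ.≟ n) then sₙ n else sᵢ n (toℕ i))
        (sym (dec-true (toℕ i ℕ.≟ 0) i≡0)))
      (s₀-realizes i≡0)
    ... | no i≢0 | yes i≡n = subst Realizes
      (cong₂ (λ b b′ → if b then s₀ n else if b′ then sₙ n else sᵢ n (toℕ i))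
        (sym (dec-false (toℕ i ℕ.≟ 0) i≢0)) (sym (dec-true (toℕ i ℕ.≟ n) i≡n)))
      (sₙ-realizes i≡n)
    ... | no i≢0 | no i≢n = subst Realizes
      (cong₂ (λ b b′ → if b then s₀ n else if b′ then sₙ n else sᵢ n (toℕ i))
        (sym (dec-false (toℕ i ℕ.≟ 0) i≢0)) (sym (dec-false (toℕ i ℕ.≟ n) i≢n)))
      (subst (Realizes ∘ sᵢ n) suc-pred (sᵢ-realizes (ℕ.pred (toℕ i)) (sym suc-pred)
        (subst (ℕ._< n) (sym suc-pred) (ℕ.≤∧≢⇒< (ℕ.s≤s⁻¹ (toℕ<n i)) i≢n))))
      where
      suc-pred : suc (ℕ.pred (toℕ i)) ≡ toℕ i
      suc-pred = ℕ.suc-pred (toℕ i) {{ℕ.≢-nonZero i≢0}}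

-- Words as permutations of the steps

act act⁻¹ : ∀ {n} → C̃ n → ℤ → ℤ
act []      k = k
act (i ∷ w) k = σ i (act w k)
act⁻¹ []      k = k
act⁻¹ (i ∷ w) k = act⁻¹ w (σ i k)

record Equivariant (n : ℕ) (f : ℤ → ℤ) : Set where
  field
    eq-⊕      : ∀ k q → f (k + q * + (2 ℕ.* n)) ≡ f k + q * + (2 ℕ.* n)
    eq-mirror : ∀ k → f (mirror k) ≡ mirror (f k)

  eq-≅ : ∀ {k l} → k ≅ l ⟨ 2 ℕ.* n ⟩ → f k ≅ f l ⟨ 2 ℕ.* n ⟩
  eq-≅ {l = l} (by q refl) = by q (eq-⊕ l q)

open Equivariant

∘-equivariant : ∀ {n f g} → Equivariant n f → Equivariant n g → Equivariant n (f ∘ g)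
∘-equivariant {f = f} E F = record
  { eq-⊕      = λ k q → trans (cong f (eq-⊕ F k q)) (eq-⊕ E _ q)
  ; eq-mirror = λ k → trans (cong f (eq-mirror F k)) (eq-mirror E _) }

module _ {n : ℕ} where

  σ-equivariant : (i : Fin (suc n)) → Equivariant n (σ i)
  σ-equivariant i = record { eq-⊕ = σ-⊕ i ; eq-mirror = σ-neg i }

  act-equivariant : (w : C̃ n) → Equivariant n (act w)
  act-equivariant []      = record { eq-⊕ = λ _ _ → refl ; eq-mirror = λ _ → refl }
  act-equivariant (i ∷ w) = ∘-equivariant (σ-equivariant i) (act-equivariant w)

  act⁻¹-equivariant : (w : C̃ n) → Equivariant n (act⁻¹ w)
  act⁻¹-equivariant []      = record { eq-⊕ = λ _ _ → refl ; eq-mirror = λ _ → refl }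
  act⁻¹-equivariant (i ∷ w) = ∘-equivariant (act⁻¹-equivariant w) (σ-equivariant i)

  act⁻¹-act : (w : C̃ n) → ∀ k → act⁻¹ w (act w k) ≡ k
  act⁻¹-act []      k = refl
  act⁻¹-act (i ∷ w) k = trans (cong (act⁻¹ w) (σ-involutive i (act w k))) (act⁻¹-act w k)

  act-act⁻¹ : (w : C̃ n) → ∀ k → act w (act⁻¹ w k) ≡ k
  act-act⁻¹ []      k = refl
  act-act⁻¹ (i ∷ w) k = trans (cong (σ i) (act-act⁻¹ w (σ i k))) (σ-involutive i k)

  act-injective : (w : C̃ n) → ∀ {k l} → act w k ≡ act w l → k ≡ l
  act-injective w {k} {l} eq = trans (sym (act⁻¹-act w k))
      (trans (cong (act⁻¹ w) eq) (act⁻¹-act w l))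

  act-++ : (v w : C̃ n) → ∀ k → act (v ++ w) k ≡ act v (act w k)
  act-++ []      w k = refl
  act-++ (i ∷ v) w k = cong (σ i) (act-++ v w k)

  act-reverse : (w : C̃ n) → ∀ k → act (reverse w) k ≡ act⁻¹ w k
  act-reverse []      k = refl
  act-reverse (i ∷ w) k = trans (cong (λ v → act v k) (unfold-reverse i w))
    (trans (act-++ (reverse w) (i ∷ []) k) (act-reverse w (σ i k)))

  module _ .{{_ : NonZero n}} where

    open Letter.Realizes

    ⟦⟧-φ : (w : C̃ n) → ∀ k → ⟦ w ⟧ (φ n k) ≡ φ n (act w k)
    ⟦⟧-φ []      k = refl
    ⟦⟧-φ (i ∷ w) k = trans (cong (gen n i) (⟦⟧-φ w k))
      (on-values (Letter.gen-realizes i) (act w k))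

    ⟦⟧-multiple : (w : C̃ n) → ∀ {x} → x ≅ 0ℤ ⟨ suc n ⟩ → ⟦ w ⟧ x ≡ x
    ⟦⟧-multiple []      x≅0 = refl
    ⟦⟧-multiple (i ∷ w) x≅0 = trans (cong (gen n i) (⟦⟧-multiple w x≅0))
      (on-multiples (Letter.gen-realizes i) x≅0)

    -- All words fix the multiples of n + 1, and on the remaining integers `⟦ w ⟧` is `act w`
    -- transported along φ.
    act⇒≈ : {v w : C̃ n} → act v ≗ act w → v ≈ w
    act⇒≈ {v} {w} eq x with position n x
    ... | multiple x≅0 = trans (⟦⟧-multiple v x≅0) (sym (⟦⟧-multiple w x≅0))
    ... | value k      = trans (⟦⟧-φ v k) (trans (cong (φ n) (eq k)) (sym (⟦⟧-φ w k)))

    ≈⇒act : {v w : C̃ n} → v ≈ w → act v ≗ act w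
    ≈⇒act {v} {w} eq k = φ-injective n (trans (sym (⟦⟧-φ v k)) (trans (eq (φ n k)) (⟦⟧-φ w k)))

-- Reflections and the exchange property

-- The counterpart of `IsTransposition` on step numbers, with `mirror` in place of negation and the
-- translates absorbed into `Equivariant`.
record Transposes (n : ℕ) (x y : ℤ) (t : ℤ → ℤ) : Set where
  field
    equivariant : Equivariant n t
    x↦y   : t x ≡ y
    y↦x   : t y ≡ x
    fixed : ∀ z → ¬ z ≅ x ⟨ 2 ℕ.* n ⟩ → ¬ z ≅ y ⟨ 2 ℕ.* n ⟩ →
            ¬ z ≅ mirror x ⟨ 2 ℕ.* n ⟩ → ¬ z ≅ mirror y ⟨ 2 ℕ.* n ⟩ → t z ≡ z

  mx↦my : t (mirror x) ≡ mirror y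
  mx↦my = trans (eq-mirror equivariant x) (cong mirror x↦y)

  my↦mx : t (mirror y) ≡ mirror x
  my↦mx = trans (eq-mirror equivariant y) (cong mirror y↦x)

module _ {n : ℕ} where

  open Transposes

  ≅? : ∀ x y → Dec (x ≅ y ⟨ 2 ℕ.* n ⟩)
  ≅? x y = map′ fromMod toMod (congruent? (2 ℕ.* n) x y)

  agree-≅ : ∀ {s t z l} → Equivariant n s → Equivariant n t →
            z ≅ l ⟨ 2 ℕ.* n ⟩ → s l ≡ t l → s z ≡ t z
  agree-≅ {l = l} S T (by q refl) eq =
    trans (eq-⊕ S l q) (trans (cong (_+ q * + (2 ℕ.* n)) eq) (sym (eq-⊕ T l q)))

  -- Equivariance spreads the values at x and y over the classes of x, y and their mirrors. This
  -- allows a conjugated letter to be recognized from a single swapped pair.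
  transposes-unique : ∀ {x y s t} → Transposes n x y s → Transposes n x y t → s ≗ t
  transposes-unique {x} {y} {s} {t} S T z
    with ≅? z x | ≅? z y | ≅? z (mirror x) | ≅? z (mirror y)
  ... | yes p | _ | _ | _ = agree-≅ (equivariant S) (equivariant T) p (trans (x↦y S) (sym (x↦y T)))
  ... | no _ | yes p | _ | _ = agree-≅ (equivariant S) (equivariant T) p
      (trans (y↦x S) (sym (y↦x T)))
  ... | no _ | no _ | yes p | _ = agree-≅ (equivariant S) (equivariant T) p
      (trans (mx↦my S) (sym (mx↦my T)))
  ... | no _ | no _ | no _ | yes p = agree-≅ (equivariant S) (equivariant T) p
      (trans (my↦mx S) (sym (my↦mx T)))
  ... | no a | no b | no c | no d = trans (fixed S z a b c d) (sym (fixed T z a b c d))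

  conjugate : ∀ (b : C̃ n) {x y t} → Transposes n (act b x) (act b y) t →
              Transposes n x y (act⁻¹ b ∘ t ∘ act b)
  conjugate b {x} {y} {t} T = record
    { equivariant = ∘-equivariant (act⁻¹-equivariant b)
        (∘-equivariant (equivariant T) (act-equivariant b))
    ; x↦y   = trans (cong (act⁻¹ b) (x↦y T)) (act⁻¹-act b y)
    ; y↦x   = trans (cong (act⁻¹ b) (y↦x T)) (act⁻¹-act b x)
    ; fixed = λ z ≇x ≇y ≇mx ≇my → trans (cong (act⁻¹ b) (fixed T (act b z)
        (≇x ∘ back refl) (≇y ∘ back refl)
        (≇mx ∘ back (eq-mirror (act-equivariant b) x))
            (≇my ∘ back (eq-mirror (act-equivariant b) y))))
        (act⁻¹-act b z)
    }
    where
    back : ∀ {z l l′} → act b l ≡ l′ → act b z ≅ l′ ⟨ 2 ℕ.* n ⟩ → z ≅ l ⟨ 2 ℕ.* n ⟩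
    back {z} {l} refl p = subst₂ (_≅_⟨ 2 ℕ.* n ⟩) (act⁻¹-act b z) (act⁻¹-act b l)
      (eq-≅ (act⁻¹-equivariant b) p)

  letter-transposes : ∀ (i : Fin (suc n)) {k} → Hit i k → Transposes n (k - 1ℤ) k (σ i)
  letter-transposes i {k} h = record
    { equivariant = σ-equivariant i
    ; x↦y   = trans (σ-up i (subst (Hit i) (sym (-1+1 k)) h)) (-1+1 k)
    ; y↦x   = σ-down i h
    ; fixed = λ z ≇k-1 ≇k ≇mk-1 ≇mk → σ-fix i
        (λ g → Sum.[ ≇k-1 ∘ down1 z , ≇mk ∘ subst (z ≅_⟨ _ ⟩) (e k) ∘ down1 z ] (hit-unique i g h))
        (λ g → Sum.[ ≇k , ≇mk-1 ∘ subst (z ≅_⟨ _ ⟩) (e′ k) ] (hit-unique i g h))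
    }
    where
    down1 : ∀ z {l} → z + 1ℤ ≅ l ⟨ 2 ℕ.* n ⟩ → z ≅ l - 1ℤ ⟨ 2 ℕ.* n ⟩
    down1 z p = subst (_≅ _ ⟨ _ ⟩) (+1-1 z) (≅-+ (- 1ℤ) p)
    e : ∀ k → - k - 1ℤ ≡ mirror k
    e = solve 1 (λ k → :- k :- con 1ℤ := con -1ℤ :- k) refl
    e′ : ∀ k → - k ≡ mirror (k - 1ℤ)
    e′ = solve 1 (λ k → :- k := con -1ℤ :- (k :- con 1ℤ)) refl

  transposes-sym : ∀ {x y t} → Transposes n x y t → Transposes n y x t
  transposes-sym T = record
    { equivariant = equivariant T ; x↦y = y↦x T ; y↦x = x↦y T
    ; fixed = λ z a b c d → fixed T z b a d c }

  σ-transposes : ∀ (i : Fin (suc n)) {x y} → σ i x ≡ y → x ≢ y → Transposes n x y (σ i)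
  σ-transposes i {x} refl x≢y with view i x
  ... | up h     = subst₂ (λ x y → Transposes n x y (σ i)) (+1-1 x) (sym (σ-up i h))
      (letter-transposes i h)
  ... | down h   = subst (λ y → Transposes n x y (σ i)) (sym (σ-down i h))
      (transposes-sym (letter-transposes i h))
  ... | fix h h′ = ⊥-elim (x≢y (sym (σ-fix i h h′)))

  σ-≤ : ∀ (i : Fin (suc n)) x → σ i x ≤ x + 1ℤ
  σ-≤ i x with view i x
  ... | up h     = ℤ.≤-reflexive (σ-up i h)
  ... | down h   = subst (_≤ x + 1ℤ) (sym (σ-down i h)) (ℤ.+-monoʳ-≤ x (-≤+))
  ... | fix h h′ = subst (_≤ x + 1ℤ) (sym (σ-fix i h h′)) (ℤ.i≤i+j x 1ℤ)

  σ-≥ : ∀ (i : Fin (suc n)) x → x ≤ σ i x + 1ℤ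
  σ-≥ i x = subst (_≤ σ i x + 1ℤ) (σ-involutive i x) (σ-≤ i (σ i x))

  -- A letter moves everything by at most 1, so it only reverses the pairs that it swaps.
  σ-inversion : ∀ (i : Fin (suc n)) {x y} → x < y → σ i y < σ i x → σ i x ≡ y
  σ-inversion i {x} {y} x<y flipped = ℤ.≤-antisym
    (ℤ.≤-trans (σ-≤ i x) (<⇒+1≤ x<y))
    (ℤ.≤-trans (σ-≥ i y) (<⇒+1≤ flipped))

  -- As the letters act from right to left, the pair starts increasing and ends decreasing, so some
  -- letter reverses it. By `σ-inversion` this letter swaps the two current images; its conjugate by
  -- the letters to its right is therefore `s`, and deleting it amounts to right multiplication by
  -- `s`.
  exchange : ∀ (w : C̃ n) {x y s} → Transposes n x y s → x < y → act w y < act w x →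
    ∃ λ v → v ⊑ w × suc (length v) ≡ length w × act v ≗ act w ∘ s
  exchange []      T x<y y<x = ⊥-elim (ℤ.<-asym x<y y<x)
  exchange (i ∷ w) {x} {y} {s} T x<y flipped with ℤ.<-cmp (act w x) (act w y)
  ... | tri> _ _ wx>wy = let v , v⊑w , len , eq = exchange w T x<y wx>wy in
    i ∷ v , refl ∷ v⊑w , cong suc len , λ k → cong (σ i) (eq k)
  ... | tri≈ _ wx≡wy _ = ⊥-elim (ℤ.<-irrefl (act-injective w wx≡wy) x<y)
  ... | tri< wx<wy wx≢wy _ = w , i ∷ʳ ⊑-refl , refl , λ k → sym
    (trans (cong (σ i) (trans (cong (act w) (sym (same k))) (act-act⁻¹ w _)))
        (σ-involutive i (act w k)))
    where
    same : act⁻¹ w ∘ σ i ∘ act w ≗ s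
    same = transposes-unique (conjugate w (σ-transposes i (σ-inversion i wx<wy flipped) wx≢wy)) T

module _ {n : ℕ} {f : ℤ → ℤ} (E : Equivariant n f) (i : Fin (suc n)) where

  -- f orders the two steps around all the diagonals k ≡ ±i in the same way.
  order-coherent : ∀ {k l} → Hit i k → Hit i l → f (k - 1ℤ) < f k → f (l - 1ℤ) < f l
  order-coherent {k} h g lt with hit-unique i g h
  ... | inj₁ (by q refl) = subst₂ _<_
      (trans (sym (eq-⊕ E (k - 1ℤ) q)) (cong f (⊕-+ {n} k q (- 1ℤ)))) (sym (eq-⊕ E k q))
      (ℤ.+-monoˡ-< (q * + (2 ℕ.* n)) lt)
  ... | inj₂ (by q refl) = subst₂ _<_
      (trans (sym (shifted k)) (cong f
          (solve 2 (λ k m → con -1ℤ :- k :+ m := :- k :+ m :- con 1ℤ) refl k m)))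
      (trans (sym (shifted (k - 1ℤ)))
        (cong f (solve 2 (λ k m → con -1ℤ :- (k :- con 1ℤ) :+ m := :- k :+ m) refl k m)))
      (ℤ.+-monoˡ-< m (ℤ.+-monoʳ-< -1ℤ (ℤ.neg-mono-< lt)))
    where
    m : ℤ
    m = q * + (2 ℕ.* n)
    shifted : ∀ k → f (mirror k + m) ≡ mirror (f k) + m
    shifted k = trans (eq-⊕ E (mirror k) q) (cong (_+ m) (eq-mirror E k))

-- Profiles, the lifting property and subwords

-- profile w k is the number of vertical steps among the steps k, k + 1, … of the boundary of the
-- diagram of w; a box of content k and row r lies in the diagram when r ≤ profile w k.
profile : ∀ {n} → C̃ n → ℤ → ℤ
profile []      (+ _)      = 0ℤ
profile []      (-[1+ m ]) = + suc m
profile (i ∷ w) k          =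
  if does (hit? i k) then profile w (k - 1ℤ) + profile w (k + 1ℤ) - profile w k else profile w k

-- Couples the sign of the preimage of a step with the drop of the profile across it, so that one
-- match yields both.
data Step (x p p₊₁ : ℤ) : Set where
  vertical   : x < 0ℤ → p ≡ p₊₁ + 1ℤ → Step x p p₊₁
  horizontal : 0ℤ ≤ x → p ≡ p₊₁ → Step x p p₊₁

-- Replacing p by c + q - p in the sequence c, p, q exchanges its two drops: a step keeps its type
-- while it moves across the diagonal.
reflect-step : ∀ {x p q} c → Step x p q → Step x c (c + q - p)
reflect-step {q = q} c (vertical x<0 refl) =
  vertical x<0 (solve 2 (λ c q → c := c :+ q :- (q :+ con 1ℤ) :+ con 1ℤ) refl c q)
reflect-step {q = q} c (horizontal 0≤x refl) =
  horizontal 0≤x (solve 2 (λ c q → c := c :+ q :- q) refl c q)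

reflect-step′ : ∀ {x p q} c → Step x p q → Step x (p + c - q) c
reflect-step′ {q = q} c (vertical x<0 refl) =
  vertical x<0 (solve 2 (λ c q → q :+ con 1ℤ :+ c :- q := c :+ con 1ℤ) refl c q)
reflect-step′ {q = q} c (horizontal 0≤x refl) =
  horizontal 0≤x (solve 2 (λ c q → q :+ c :- q := c) refl c q)

step-≤ : ∀ {x p q} → Step x p q → q ≤ p
step-≤ (vertical _ refl)   = ℤ.i≤i+j _ 1ℤ
step-≤ (horizontal _ refl) = ℤ.≤-refl

step-≥ : ∀ {x p q} → Step x p q → p ≤ q + 1ℤ
step-≥ (vertical _ refl)   = ℤ.≤-refl
step-≥ (horizontal _ refl) = ℤ.i≤i+j _ 1ℤ

module _ {n : ℕ} where

  profile-hit : ∀ (i : Fin (suc n)) w {k} → Hit i k →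
    profile (i ∷ w) k ≡ profile w (k - 1ℤ) + profile w (k + 1ℤ) - profile w k
  profile-hit i w {k} h rewrite dec-true (hit? i k) h = refl

  profile-miss : ∀ (i : Fin (suc n)) w {k} → ¬ Hit i k → profile (i ∷ w) k ≡ profile w k
  profile-miss i w {k} h rewrite dec-false (hit? i k) h = refl

  miss-1 : ∀ (i : Fin (suc n)) {k} → Hit i k → ¬ Hit i (k - 1ℤ)
  miss-1 i {k} h g = hit-exclusive i g (subst (Hit i) (sym (-1+1 k)) h)

  -- By induction on the word: σ moves the steps exactly as the reflection of the profile moves the
  -- drops.
  step : ∀ (w : C̃ n) k → Step (act⁻¹ w k) (profile w k) (profile w (k + 1ℤ))
  step []      (+ m)            = horizontal (+≤+ ℕ.z≤n) refl
  step []      (-[1+ zero ])    = vertical -<+ refl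
  step []      (-[1+ suc m ])   = vertical -<+ (cong +_ (ℕ.+-comm 1 (suc m)))
  step (i ∷ w) k with view i k
  ... | up h     = subst₂ (λ x p → Step x p (profile (i ∷ w) (k + 1ℤ)))
      (cong (act⁻¹ w) (sym (σ-up i h))) (sym (profile-miss i w λ g → hit-exclusive i g h))
      (subst (Step _ (profile w k))
        (sym (trans (profile-hit i w h)
            (cong (λ l → profile w l + profile w (k + 1ℤ + 1ℤ) - profile w (k + 1ℤ)) (+1-1 k))))
        (reflect-step (profile w k) (step w (k + 1ℤ))))
  ... | down h   = subst₂ (λ x q → Step x (profile (i ∷ w) k) q)
      (cong (act⁻¹ w) (sym (σ-down i h))) (sym (profile-miss i w (hit-exclusive i h)))
      (subst (λ p → Step (act⁻¹ w (k - 1ℤ)) p (profile w (k + 1ℤ))) (sym (profile-hit i w h))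
        (reflect-step′ (profile w (k + 1ℤ))
            (subst (λ l → Step (act⁻¹ w (k - 1ℤ)) (profile w (k - 1ℤ)) (profile w l)) (-1+1 k)
          (step w (k - 1ℤ)))))

  ... | fix h h′ = subst₂ (Step _) (sym (profile-miss i w h′)) (sym (profile-miss i w h))
      (subst (λ x → Step x (profile w k) (profile w (k + 1ℤ))) (cong (act⁻¹ w) (sym (σ-fix i h h′)))
          (step w k))

  step-1 : ∀ (w : C̃ n) k → Step (act⁻¹ w (k - 1ℤ)) (profile w (k - 1ℤ)) (profile w k)
  step-1 w k = subst (λ l → Step (act⁻¹ w (k - 1ℤ)) (profile w (k - 1ℤ)) (profile w l)) (-1+1 k)
      (step w (k - 1ℤ))

  -- `profile []` is the maximum of 0 and -k.
  profile-[]-minimal : ∀ {f : ℤ → ℤ} → (∀ k → 0ℤ ≤ f k) → (∀ k → - k ≤ f k) → ∀ k →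
      profile {n} [] k ≤ f k
  profile-[]-minimal f≥0 f≥- (+ m)      = f≥0 (+ m)
  profile-[]-minimal f≥0 f≥- (-[1+ m ]) = f≥- (-[1+ m ])

  profile-≥0 : ∀ (w : C̃ n) k → 0ℤ ≤ profile w k
  profile-≥0 []      (+ _)      = ℤ.≤-refl
  profile-≥0 []      (-[1+ _ ]) = +≤+ ℕ.z≤n
  profile-≥0 (i ∷ w) k with hit? i k
  ... | no _  = profile-≥0 w k
  ... | yes h = ≤-gap₂ (step-≤ (step-1 w k)) (profile-≥0 w (k + 1ℤ))
    (solve 3 (λ a b c → (a :- b) :+ (c :- con 0ℤ) := a :+ c :- b :- con 0ℤ) refl
      (profile w (k - 1ℤ)) (profile w k) (profile w (k + 1ℤ)))

  -- A reflected value is at least `profile w (k - 1ℤ) - 1ℤ`, because step k drops by at most 1. The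
  -- bound keeps the boundary to the right of the first column, as `profile-≥0` keeps it above the
  -- first row.
  profile-≥- : ∀ (w : C̃ n) k → - k ≤ profile w k
  profile-≥- []      (+ zero)   = ℤ.≤-refl
  profile-≥- []      (+ suc _)  = -≤+
  profile-≥- []      (-[1+ _ ]) = ℤ.≤-refl
  profile-≥- (i ∷ w) k with hit? i k
  ... | no _  = profile-≥- w k
  ... | yes h = ≤-gap₂ (step-≥ (step w k)) (profile-≥- w (k - 1ℤ))
    (solve 4 (λ a b c k → (c :+ con 1ℤ :- b) :+ (a :- (:- (k :- con 1ℤ))) := a :+ c :- b :- (:- k))
        refl
      (profile w (k - 1ℤ)) (profile w k) (profile w (k + 1ℤ)) k)

  profile-cong : ∀ (i : Fin (suc n)) {v w} → profile v ≗ profile w →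
      profile (i ∷ v) ≗ profile (i ∷ w)
  profile-cong i eq k with does (hit? i k)
  ... | true  = cong₂ _-_ (cong₂ _+_ (eq (k - 1ℤ)) (eq (k + 1ℤ))) (eq k)
  ... | false = eq k

  profile-neighbours : ∀ (i : Fin (suc n)) w {k} → Hit i k →
    profile w k + profile (i ∷ w) k ≡ profile w (k - 1ℤ) + profile w (k + 1ℤ)
  profile-neighbours i w {k} h = trans (cong (_+_ (profile w k)) (profile-hit i w h))
    (solve 2 (λ a b → a :+ (b :- a) := b) refl (profile w k)
        (profile w (k - 1ℤ) + profile w (k + 1ℤ)))

  profile-involutive : ∀ (i : Fin (suc n)) w → profile (i ∷ i ∷ w) ≗ profile w
  profile-involutive i w k = by-cases (hit? i k)
    where
    by-cases : Dec (Hit i k) → profile (i ∷ i ∷ w) k ≡ profile w k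
    by-cases (no h)  = trans (profile-miss i (i ∷ w) h) (profile-miss i w h)
    by-cases (yes h) = trans (profile-hit i (i ∷ w) h)
      (trans (cong₂ (λ a b → a + b - profile (i ∷ w) k)
        (profile-miss i w (miss-1 i h)) (profile-miss i w (hit-exclusive i h)))
      (trans (cong (_- profile (i ∷ w) k) (sym (profile-neighbours i w h)))
        (solve 2 (λ a b → a :+ b :- b := a) refl (profile w k) (profile (i ∷ w) k))))

  profile-≤+1 : ∀ (i : Fin (suc n)) w k → profile (i ∷ w) k ≤ profile w k + 1ℤ
  profile-≤+1 i w k with hit? i k
  ... | no _  = ℤ.i≤i+j _ 1ℤ
  ... | yes h = ≤-gap₂ (step-≥ (step-1 w k)) (step-≤ (step w k))
    (solve 3 (λ a b c → (b :+ con 1ℤ :- a) :+ (b :- c) := b :+ con 1ℤ :- (a :+ c :- b)) refl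
      (profile w (k - 1ℤ)) (profile w k) (profile w (k + 1ℤ)))

  -- Left ascents and left descents of `w`, read off from the inverse permutation.
  Rises Falls : Fin (suc n) → C̃ n → Set
  Rises i w = ∀ k → Hit i k → act⁻¹ w (k - 1ℤ) < act⁻¹ w k
  Falls i w = ∀ k → Hit i k → act⁻¹ w k < act⁻¹ w (k - 1ℤ)

  rises : ∀ {i w k} → Hit i k → act⁻¹ w (k - 1ℤ) < act⁻¹ w k → Rises i w
  rises {i} {w} h lt l g = order-coherent (act⁻¹-equivariant w) i h g lt

  act⁻¹-injective : ∀ (w : C̃ n) {k l} → act⁻¹ w k ≡ act⁻¹ w l → k ≡ l
  act⁻¹-injective w {k} {l} eq = trans (sym (act-act⁻¹ w k))
      (trans (cong (act w) eq) (act-act⁻¹ w l))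

  rises⊎falls : ∀ i w → Rises i w ⊎ Falls i w
  rises⊎falls i w with ℤ.<-cmp (act⁻¹ w (+ toℕ i - 1ℤ)) (act⁻¹ w (+ toℕ i))
  ... | tri< lt _ _ = inj₁ (rises {w = w} (hit⁺ (≅-reflexive refl)) lt)
  ... | tri≈ _ eq _ = ⊥-elim (ℤ.<-irrefl (act⁻¹-injective w eq) (k-1<k (+ toℕ i)))
  ... | tri> _ _ gt = inj₂ λ k h → ℤ.≰⇒> λ le → ℤ.<-asym gt
    (rises {w = w} h (ℤ.≤∧≢⇒< le λ eq → ℤ.<-irrefl (act⁻¹-injective w eq) (k-1<k k)) _
        (hit⁺ (≅-reflexive refl)))

  -- At a hit diagonal the profile changes by the drop of step k - 1 minus that of step k. It could
  -- decrease only for a horizontal step before a vertical one, whose preimages satisfy 0 ≤ x and y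
  -- < 0, against x < y.
  profile-rises : ∀ {i w} → Rises i w → ∀ k → profile w k ≤ profile (i ∷ w) k
  profile-rises {i} {w} R k with hit? i k
  ... | no _  = ℤ.≤-refl
  ... | yes h = ≤-gap (compare (step-1 w k) (step w k) (R k h))
      (solve 3 (λ a b c → a :- b :- (b :- c) := a :+ c :- b :- b) refl
        (profile w (k - 1ℤ)) (profile w k) (profile w (k + 1ℤ)))
    where
    compare : ∀ {x y p q r} → Step x p q → Step y q r → x < y → q - r ≤ p - q
    compare {r = r} (vertical _ refl) (vertical _ refl) _ = ℤ.≤-reflexive
      (solve 1 (λ r → r :+ con 1ℤ :- r := r :+ con 1ℤ :+ con 1ℤ :- (r :+ con 1ℤ)) refl r)
    compare {r = r} (vertical _ refl) (horizontal _ refl) _ = ≤-gap (+≤+ {0} {1} ℕ.z≤n)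
      (solve 1 (λ r → con 1ℤ :- con 0ℤ := r :+ con 1ℤ :- r :- (r :- r)) refl r)
    compare (horizontal 0≤x _) (vertical y<0 _) x<y = ⊥-elim
        (ℤ.<-irrefl refl (ℤ.≤-<-trans 0≤x (ℤ.<-trans x<y y<0)))
    compare {r = r} (horizontal _ refl) (horizontal _ refl) _ = ℤ.≤-refl

  -- If `i` falls for `w`, then it rises for `i ∷ w`, and applying it once more returns the profile
  -- of `w`.
  profile-falls : ∀ {i w} → Falls i w → ∀ k → profile (i ∷ w) k ≤ profile w k
  profile-falls {i} {w} F k = subst (profile (i ∷ w) k ≤_) (profile-involutive i w k)
    (profile-rises {i} {i ∷ w} R k)
    where
    R : Rises i (i ∷ w)
    R k h = subst₂ _<_
      (cong (act⁻¹ w) (trans (sym (-1+1 k)) (sym (σ-up i (subst (Hit i) (sym (-1+1 k)) h)))))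
      (cong (act⁻¹ w) (sym (σ-down i h))) (F k h)

  -- Only a hit diagonal needs an argument. Its neighbours are not hit, so there `w` is bounded by
  -- `u` itself. The values of `w` and `i ∷ w` at k add up to the sum of the two neighbours, and
  -- likewise for `u`. Hence 2 ν k is at most the sum for `u`, which is at most 2 `profile u k` + 1,
  -- and parity removes the 1. In use, ν is the smaller of the profiles of `w` and `i ∷ w`.
  lifting : ∀ (i : Fin (suc n)) w u (ν : ℤ → ℤ) → (∀ k → ν k ≤ profile w k) →
      (∀ k → ν k ≤ profile (i ∷ w) k) →
    (∀ k → profile w k ≤ profile (i ∷ u) k) → ∀ k → ν k ≤ profile u k
  lifting i w u ν ν≤w ν≤iw w≤iu k with hit? i k
  ... | no h  = ℤ.≤-trans (ν≤w k) (subst (profile w k ≤_) (profile-miss i u h) (w≤iu k))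
  ... | yes h = ℤ.≮⇒≥ λ u<ν → ℤ.<⇒≱ (double u<ν)
      (ℤ.≤-trans (ℤ.+-mono-≤ (ν≤w k) (ν≤iw k))
      (ℤ.≤-trans (ℤ.≤-reflexive (profile-neighbours i w h))
      (ℤ.≤-trans (ℤ.+-mono-≤ (at (k - 1ℤ) (miss-1 i h)) (at (k + 1ℤ) (hit-exclusive i h)))
      (ℤ.≤-trans (ℤ.≤-reflexive (sym (profile-neighbours i u h)))
      (ℤ.+-monoʳ-≤ (profile u k) (profile-≤+1 i u k))))))
    where
    at : ∀ l → ¬ Hit i l → profile w l ≤ profile u l
    at l h = subst (profile w l ≤_) (profile-miss i u h) (w≤iu l)
    double : ∀ {a b} → a < b → a + (a + 1ℤ) < b + b
    double {a} {b} a<b = +1≤⇒< (≤-gap₂ (<⇒+1≤ a<b) (<⇒+1≤ a<b)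
      (solve 2 (λ a b → (b :- (a :+ con 1ℤ)) :+ (b :- (a :+ con 1ℤ)) := b :+ b :-
          (a :+ (a :+ con 1ℤ) :+ con 1ℤ)) refl a b))

  -- Induction on the larger word. If `i` falls for `u`, dropping the first letter only enlarges the
  -- bound. Otherwise `lifting` puts the smaller of `w` and `i ∷ w` below `u`; the letter is dropped
  -- in the first case and kept in the second.
  subword : ∀ (u w : C̃ n) → (∀ k → profile w k ≤ profile u k) → ∃ λ v →
      v ⊑ u × profile v ≗ profile w
  subword []      w w≤[] = [] , [] , λ k → ℤ.≤-antisym
    (profile-[]-minimal (profile-≥0 w) (profile-≥- w) k) (w≤[] k)
  subword (i ∷ u) w w≤iu with rises⊎falls i u | rises⊎falls i w
  ... | inj₂ F | _ =
    let v , v⊑u , eq = subword u w λ k → ℤ.≤-trans (w≤iu k) (profile-falls {i} {u} F k)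
    in v , i ∷ʳ v⊑u , eq
  ... | inj₁ _ | inj₁ R =
    let v , v⊑u , eq = subword u w
          (lifting i w u (profile w) (λ _ → ℤ.≤-refl) (profile-rises {i} {w} R) w≤iu)
    in v , i ∷ʳ v⊑u , eq
  ... | inj₁ _ | inj₂ F =
    let v , v⊑u , eq = subword u (i ∷ w)
          (lifting i w u (profile (i ∷ w)) (profile-falls {i} {w} F) (λ _ → ℤ.≤-refl) w≤iu)
    in i ∷ v , refl ∷ v⊑u , λ k → trans (profile-cong i {v} {i ∷ w} eq k) (profile-involutive i w k)

-- Profiles determine cosets, and ascending words the elements

<⇒-<0 : ∀ {x y} → x < y → x - y < 0ℤ
<⇒-<0 {x} {y} x<y = +1≤⇒< (≤-gap (<⇒+1≤ x<y)
  (solve 2 (λ x y → y :- (x :+ con 1ℤ) := con 0ℤ :- (x :- y :+ con 1ℤ)) refl x y))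

-<0⇒< : ∀ {x y} → x - y < 0ℤ → x < y
-<0⇒< {x} {y} lt = +1≤⇒< (≤-gap (<⇒+1≤ lt)
  (solve 2 (λ x y → con 0ℤ :- (x :- y :+ con 1ℤ) := y :- (x :+ con 1ℤ)) refl x y))

step-difference : ∀ {x y p p₊₁ r r₊₁} → (x < 0ℤ → y < 0ℤ) → (y < 0ℤ → x < 0ℤ) →
  Step x p p₊₁ → Step y r r₊₁ → p - r ≡ p₊₁ - r₊₁
step-difference {p₊₁ = p} {r₊₁ = r} _ _ (vertical _ refl) (vertical _ refl) =
  solve 2 (λ p r → p :+ con 1ℤ :- (r :+ con 1ℤ) := p :- r) refl p r
step-difference _ _ (horizontal _ refl) (horizontal _ refl) = refl
step-difference to _ (vertical x<0 _) (horizontal 0≤y _) = ⊥-elim (ℤ.<⇒≱ (to x<0) 0≤y)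
step-difference _ from (horizontal 0≤x _) (vertical y<0 _) = ⊥-elim (ℤ.<⇒≱ (from y<0) 0≤x)

module _ {n : ℕ} where

  profile-vanishes : ∀ (w : C̃ n) → ∃ λ (K : ℕ) → ∀ k → + K ≤ k → profile w k ≡ 0ℤ
  profile-vanishes []      = 0 , λ { (+ _) _ → refl }
  profile-vanishes (i ∷ w) = let K , vanishes = profile-vanishes w in
    suc K , λ k 1+K≤k → zero-at (vanishes (k - 1ℤ) (≤-gap 1+K≤k (e (+ K) k)))
      (vanishes (k + 1ℤ) (≤-gap₂ 1+K≤k (+≤+ {0} {2} ℕ.z≤n) (e′ (+ K) k)))
      (vanishes k (≤-gap₂ 1+K≤k (+≤+ {0} {1} ℕ.z≤n) (e″ (+ K) k)))
    where
    e : ∀ K k → k - (1ℤ + K) ≡ k - 1ℤ - K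
    e = solve 2 (λ K k → k :- (con 1ℤ :+ K) := k :- con 1ℤ :- K) refl
    e′ : ∀ K k → k - (1ℤ + K) + + 2 ≡ k + 1ℤ - K
    e′ = solve 2 (λ K k → k :- (con 1ℤ :+ K) :+ con (+ 2) := k :+ con 1ℤ :- K) refl
    e″ : ∀ K k → k - (1ℤ + K) + + 1 ≡ k - K
    e″ = solve 2 (λ K k → k :- (con 1ℤ :+ K) :+ con (+ 1) := k :- K) refl
    zero-at : ∀ {k} → profile w (k - 1ℤ) ≡ 0ℤ → profile w (k + 1ℤ) ≡ 0ℤ → profile w k ≡ 0ℤ →
              profile (i ∷ w) k ≡ 0ℤ
    zero-at {k} a b c with does (hit? i k)
    ... | true  = cong₂ _-_ (cong₂ _+_ a b) c
    ... | false = c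

  -- Equal signs mean equal drops, so the difference of the profiles is constant in k, and far to
  -- the right both vanish.
  profile-cong-signs : ∀ (v w : C̃ n) → (∀ k → act⁻¹ v k < 0ℤ → act⁻¹ w k < 0ℤ) →
    (∀ k → act⁻¹ w k < 0ℤ → act⁻¹ v k < 0ℤ) → profile v ≗ profile w
  -- Moving `∣ k ∣` steps to the right reaches a nonnegative number, and `Kv` + `Kw` more steps pass
  -- both thresholds.
  profile-cong-signs v w to from k = ℤ.i-j≡0⇒i≡j _ _ (trans (difference k (∣ k ∣ ℕ.+ (Kv ℕ.+ Kw)))
    (cong₂ _-_ (vanishes-v _ (far (ℕ.m≤m+n Kv Kw))) (vanishes-w _ (far (ℕ.m≤n+m Kw Kv)))))
    where
    open Σ (profile-vanishes v) renaming (proj₁ to Kv; proj₂ to vanishes-v)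
    open Σ (profile-vanishes w) renaming (proj₁ to Kw; proj₂ to vanishes-w)
    0≤k+∣k∣ : ∀ k → 0ℤ ≤ k + + ∣ k ∣
    0≤k+∣k∣ (+ _)      = +≤+ ℕ.z≤n
    0≤k+∣k∣ (-[1+ m ]) = ℤ.≤-reflexive (sym (ℤ.+-inverseˡ (+ suc m)))
    far : ∀ {K m} → K ℕ.≤ m → + K ≤ k + + (∣ k ∣ ℕ.+ m)
    far {K} {m} K≤m = ≤-gap₂ (0≤k+∣k∣ k) (+≤+ K≤m)
      (solve 4 (λ k a m K → k :+ a :- con 0ℤ :+ (m :- K) := k :+ (a :+ m) :- K) refl k (+ ∣ k ∣)
          (+ m) (+ K))
    difference : ∀ k m → profile v k - profile w k ≡ profile v (k + + m) - profile w (k + + m)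
    difference k zero    = cong (λ l → profile v l - profile w l) (sym (ℤ.+-identityʳ k))
    difference k (suc m) = trans (step-difference (to k) (from k) (step v k) (step w k))
      (trans (difference (k + 1ℤ) m)
          (cong (λ l → profile v l - profile w l) (ℤ.+-assoc k 1ℤ (+ m))))

  profile-signs : ∀ {v w : C̃ n} → profile v ≗ profile w → ∀ k → act⁻¹ v k < 0ℤ → act⁻¹ w k < 0ℤ
  profile-signs {v} {w} eq k v<0 with step v k | step w k
  ... | _                  | vertical w<0 _   = w<0
  ... | horizontal 0≤v _   | horizontal _ _   = ⊥-elim (ℤ.<⇒≱ v<0 0≤v)
  ... | vertical _ p≡q+1   | horizontal _ r≡s = ⊥-elim (ℤ.<-irrefl refl
    (+1≤⇒< (ℤ.≤-reflexive (trans (sym p≡q+1) (trans (eq k) (trans r≡s (sym (eq (k + 1ℤ)))))))))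

  -- The chain w(0) < w(1) < ... < w(n): no right descent at a generator of Cₙ.
  record Ascending (w : C̃ n) : Set where
    constructor ascending
    field
      ascends-at : ∀ (i : Fin (suc n)) → i ≢ Fin.zero → act w (+ toℕ i - 1ℤ) < act w (+ toℕ i)

  ascending⊎descent : ∀ w → Ascending w ⊎
    ∃ λ (i : Fin (suc n)) → i ≢ Fin.zero × act w (+ toℕ i) < act w (+ toℕ i - 1ℤ)
  ascending⊎descent w with any?
      (λ i → ¬? (i Fin.≟ Fin.zero) ×-dec (act w (+ toℕ i) ℤ.<? act w (+ toℕ i - 1ℤ)))
  ... | yes descent = inj₂ descent
  ... | no ¬descent = inj₁ (ascending λ i i≢0 → ℤ.≤∧≢⇒< (ℤ.≮⇒≥ λ lt → ¬descent (i , i≢0 , lt))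
    λ eq → ℤ.<-irrefl (act-injective w eq) (k-1<k (+ toℕ i)))

  -- A positive `toℕ i` is at most n, hence below 2n and not divisible by it. So only the letter 0
  -- exchanges the steps -1 and 0, and only it can change a sign.
  hit-zero : ∀ {i : Fin (suc n)} → Hit i 0ℤ → i ≡ Fin.zero
  hit-zero {i} h = go (toℕ i) refl
    where
    go : ∀ j → toℕ i ≡ j → i ≡ Fin.zero
    go zero    eq = Fin.toℕ-injective eq
    go (suc p) eq = ⊥-elim (ℕ.<⇒≱ (ℕ.m<m+n n n+0>0) (ℕ.≤-trans (ℕ.∣⇒≤ (∣p+1 h)) p<n))
      where
      p<n : suc p ℕ.≤ n
      p<n = ℕ.s≤s⁻¹ (subst (ℕ._< suc n) eq (toℕ<n i))
      n+0>0 : 0 ℕ.< n ℕ.+ 0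
      n+0>0 = subst (0 ℕ.<_) (sym (ℕ.+-identityʳ n)) (ℕ.≤-trans (ℕ.s≤s ℕ.z≤n) p<n)
      ∣p+1 : Hit i 0ℤ → 2 ℕ.* n ℕ.∣ suc p
      ∣p+1 (hit⁺ x) = ∣⇒∣ᵤ (subst (λ j → + (2 ℕ.* n) ∣ 0ℤ - + j) eq (toMod x))
      ∣p+1 (hit⁻ x) = ∣⇒∣ᵤ (subst (λ j → + (2 ℕ.* n) ∣ 0ℤ - (- + j)) eq (toMod x))

  sign-preserved : ∀ {i : Fin (suc n)} → i ≢ Fin.zero → ∀ {k} → k < 0ℤ → σ i k < 0ℤ
  sign-preserved {i} i≢0 {k} k<0 with view i k
  ... | up h     = subst (_< 0ℤ) (sym (σ-up i h))
      (ℤ.≤∧≢⇒< (subst (_≤ 0ℤ) (ℤ.+-comm 1ℤ k) (ℤ.i<j⇒suc[i]≤j k<0))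
                     λ eq → i≢0 (hit-zero (subst (Hit i) eq h)))
  ... | down h   = subst (_< 0ℤ) (sym (σ-down i h)) (ℤ.<-trans (k-1<k k) k<0)
  ... | fix h h′ = subst (_< 0ℤ) (sym (σ-fix i h h′)) k<0

  -- Right multiplication by the letter `i` composes the inverse with `σ i` on the left, which keeps
  -- every sign when `i` is not 0. The profile is thus an invariant of the coset `w Cₙ`.
  profile-invariant : ∀ {v w : C̃ n} {i} → i ≢ Fin.zero → act v ≗ act w ∘ σ i →
      profile v ≗ profile w
  profile-invariant {v} {w} {i} i≢0 eq = profile-cong-signs v w
    (λ k → subst (_< 0ℤ) (trans (cong (σ i) (inverse k)) (σ-involutive i _)) ∘ sign-preserved i≢0)
    (λ k → subst (_< 0ℤ) (sym (inverse k)) ∘ sign-preserved i≢0)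
    where
    inverse : ∀ k → act⁻¹ v k ≡ σ i (act⁻¹ w k)
    inverse k = act-injective v (trans (act-act⁻¹ v k) (sym (trans (eq _)
      (trans (cong (act w) (σ-involutive i _)) (act-act⁻¹ w k)))))

  -- A descent at a letter of Cₙ is undone by `exchange` at the price of a deleted letter, so the
  -- process terminates inside the subwords of `w` and inside its coset.
  sort : ∀ (w : C̃ n) → ∃ λ v → v ⊑ w × Ascending v × profile v ≗ profile w
  sort w = go w (<-wellFounded (length w))
    where
    go : ∀ w → Acc ℕ._<_ (length w) → ∃ λ v → v ⊑ w × Ascending v × profile v ≗ profile w
    go w (acc rec) with ascending⊎descent w
    ... | inj₁ asc = w , ⊑-refl , asc , λ _ → refl
    ... | inj₂ (i , i≢0 , desc) =
      let w′ , w′⊑w , len , eq = exchange w (letter-transposes i (hit⁺ (≅-reflexive refl)))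
            (k-1<k (+ toℕ i)) desc
          v , v⊑w′ , asc , eq′ = go w′ (rec (ℕ.≤-reflexive len))
      in v , ⊑-trans v⊑w′ w′⊑w , asc , λ k → trans (eq′ k) (profile-invariant {w′} {w} i≢0 eq k)

  module Window {w : C̃ n} (asc : Ascending w) where

    open Ascending asc

    ascends : ∀ r → suc r ℕ.< 2 ℕ.* n → act w (+ r) < act w (+ suc r)
    ascends r r+1<2n with suc r ℕ.≤? n
    ... | yes r<n = subst (λ p → act w (+ p - 1ℤ) < act w (+ p)) (toℕ-fromℕ< (ℕ.s≤s r<n))
      (ascends-at (fromℕ< (ℕ.s≤s r<n)) λ i≡0 →
          ℕ.1+n≢0 (trans (sym (toℕ-fromℕ< (ℕ.s≤s r<n))) (cong toℕ i≡0)))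
    -- Past n, the diagonal r + 1 is congruent to -i for i = 2n - (r + 1), again a letter of Cₙ, and
    -- the order around i carries over.
    ... | no r≮n = order-coherent (act-equivariant w) i {+ toℕ i} {+ suc r}
        (hit⁺ (≅-reflexive refl))
        (hit⁻ (by 1ℤ (trans (trans (cong +_ (sym (ℕ.m∸[m∸n]≡n (ℕ.<⇒≤ r+1<2n))))
            (trans (sym (ℤ.⊖-≥ (ℕ.m∸n≤m (2 ℕ.* n) (suc r))))
                (sym (ℤ.m-n≡m⊖n (2 ℕ.* n) (2 ℕ.* n ℕ.∸ suc r)))))
          (trans (solve 2 (λ m j → m :- j := :- j :+ con 1ℤ :* m) refl (+ (2 ℕ.* n))
              (+ (2 ℕ.* n ℕ.∸ suc r)))
            (cong (λ j → - + j + 1ℤ * + (2 ℕ.* n)) (sym toℕi))))))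
        (ascends-at i λ i≡0 → ℕ.m>n⇒m∸n≢0 r+1<2n (trans (sym toℕi) (cong toℕ i≡0)))
      where
      small : 2 ℕ.* n ℕ.∸ suc r ℕ.< suc n
      small = ℕ.s≤s (ℕ.≤-trans (ℕ.∸-monoʳ-≤ (2 ℕ.* n) (ℕ.<⇒≤ (ℕ.≰⇒> r≮n)))
        (ℕ.≤-reflexive (trans (ℕ.m+n∸m≡n n (n ℕ.+ 0)) (ℕ.+-identityʳ n))))
      i : Fin (suc n)
      i = fromℕ< small
      toℕi : toℕ i ≡ 2 ℕ.* n ℕ.∸ suc r
      toℕi = toℕ-fromℕ< small

    increasing : ∀ r s → r ℕ.< s → s ℕ.< 2 ℕ.* n → act w (+ r) < act w (+ s)
    increasing r (suc s) (ℕ.s≤s r≤s) s+1<2n with ℕ.m≤n⇒m<n∨m≡n r≤s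
    ... | inj₁ r<s  = ℤ.<-trans (increasing r s r<s (ℕ.<-trans (ℕ.n<1+n s) s+1<2n))
        (ascends s s+1<2n)
    ... | inj₂ refl = ascends s s+1<2n

    reflects-< : ∀ r s → r ℕ.< 2 ℕ.* n → s ℕ.< 2 ℕ.* n → act w (+ r) < act w (+ s) → r ℕ.< s
    reflects-< r s r<2n s<2n lt = ℕ.≰⇒> λ s≤r →
        Sum.[ (λ s<r → ℤ.<-asym lt (increasing s r s<r r<2n))
      , (λ { refl → ℤ.<-irrefl refl lt }) ] (ℕ.m≤n⇒m<n∨m≡n s≤r)

  module _ {v w : C̃ n} (asc-v : Ascending v) (asc-w : Ascending w)
      (eq : profile v ≗ profile w) where

    transition : ℤ → ℤ
    transition = act⁻¹ v ∘ act w

    transition-equivariant : Equivariant n transition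
    transition-equivariant = ∘-equivariant (act⁻¹-equivariant v) (act-equivariant w)

    transition-negative⁺ : ∀ k → transition k < 0ℤ → k < 0ℤ
    transition-negative⁺ k fk<0 = subst (_< 0ℤ) (act⁻¹-act w k)
        (profile-signs {v} {w} eq (act w k) fk<0)

    transition-negative⁻ : ∀ k → k < 0ℤ → transition k < 0ℤ
    transition-negative⁻ k k<0 = profile-signs {w} {v} (sym ∘ eq) (act w k)
        (subst (_< 0ℤ) (sym (act⁻¹-act w k)) k<0)

    -- Equal profiles make the transition preserve signs: at r this gives the lower bound 0, and at
    -- r - 2n the upper bound 2n.
    in-window : ∀ r → r ℕ.< 2 ℕ.* n → ∃ λ s → s ℕ.< 2 ℕ.* n × transition (+ r) ≡ + s
    in-window r r<2n = nonneg (transition (+ r)) refl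
      where
      e : ∀ x m → x + -1ℤ * m ≡ x - m
      e = solve 2 (λ x m → x :+ con -1ℤ :* m := x :- m) refl
      nonneg : ∀ x → transition (+ r) ≡ x → ∃ λ s → s ℕ.< 2 ℕ.* n × transition (+ r) ≡ + s
      nonneg -[1+ m ] fr≡x = ⊥-elim
          (ℤ.<⇒≱ (transition-negative⁺ (+ r) (subst (_< 0ℤ) (sym fr≡x) -<+)) (+≤+ ℕ.z≤n))
      nonneg (+ s) fr≡x = s , ℤ.drop‿+<+
          (-<0⇒< (subst (_< 0ℤ) (trans (eq-⊕ transition-equivariant (+ r) -1ℤ)
          (trans (e (transition (+ r)) (+ (2 ℕ.* n))) (cong (_- + (2 ℕ.* n)) fr≡x)))
          (transition-negative⁻ _ (subst (_< 0ℤ) (sym (e (+ r) (+ (2 ℕ.* n))))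
              (<⇒-<0 (+<+ r<2n)))))) , fr≡x

    -- `act w` increases on the window and `act v` reflects the order there, so the transition is a
    -- strictly increasing map of the window to itself.
    window-≤ : ∀ r → r ℕ.< 2 ℕ.* n → + r ≤ act⁻¹ v (act w (+ r))
    window-≤ zero    0<2n   = let s , _ , fr≡s = in-window 0 0<2n in subst (0ℤ ≤_) (sym fr≡s)
        (+≤+ ℕ.z≤n)
    window-≤ (suc r) r+1<2n =
      let r<2n = ℕ.<-trans (ℕ.n<1+n r) r+1<2n
          s , s<2n , fr≡s = in-window r r<2n
          s′ , s′<2n , fr+1≡s′ = in-window (suc r) r+1<2n
          s<s′ = Window.reflects-< {v} asc-v s s′ s<2n s′<2n
                   (subst₂ _<_ (trans (sym (act-act⁻¹ v _)) (cong (act v) fr≡s))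
                       (trans (sym (act-act⁻¹ v _)) (cong (act v) fr+1≡s′))
                     (Window.ascends {w} asc-w r r+1<2n))
      in subst (+ suc r ≤_) (sym fr+1≡s′)
          (+≤+ (ℕ.≤-<-trans (ℤ.drop‿+≤+ (subst (+ r ≤_) fr≡s (window-≤ r r<2n))) s<s′))

  -- `window-≤`, applied to the transition and to its inverse, leaves only the identity on the
  -- window; periodicity extends it to all steps.
  ascending-unique : .{{_ : NonZero n}} → ∀ {v w : C̃ n} → Ascending v → Ascending w →
      profile v ≗ profile w →
    act v ≗ act w
  ascending-unique {v} {w} asc-v asc-w eq k = trans (cong (act v) (sym (identity k)))
      (act-act⁻¹ v (act w k))
    where
    instance
      2n≢0 : NonZero (2 ℕ.* n)
      2n≢0 = ℕ.m*n≢0 2 n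
    on-window : ∀ r → r ℕ.< 2 ℕ.* n → act⁻¹ v (act w (+ r)) ≡ + r
    on-window r r<2n =
      let s , s<2n , fr≡s = in-window asc-v asc-w eq r r<2n
          s≤r = subst (+ s ≤_) (trans
              (cong (act⁻¹ w) (trans (cong (act v) (sym fr≡s)) (act-act⁻¹ v _)))
              (act⁻¹-act w (+ r)))
                  (window-≤ asc-w asc-v (sym ∘ eq) s s<2n)
      in ℤ.≤-antisym (subst (_≤ + r) (sym fr≡s) s≤r) (window-≤ asc-v asc-w eq r r<2n)
    identity : ∀ k → act⁻¹ v (act w k) ≡ k
    identity k = subst (λ k → act⁻¹ v (act w k) ≡ k) (sym (a≡a%ℕn+[a/ℕn]*n k (2 ℕ.* n)))
      (trans (eq-⊕ (∘-equivariant (act⁻¹-equivariant v) (act-equivariant w)) (+ (k %ℕ (2 ℕ.* n)))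
          (k /ℕ (2 ℕ.* n)))
        (cong (_+ (k /ℕ (2 ℕ.* n)) * + (2 ℕ.* n)) (on-window _ (n%ℕd<d k (2 ℕ.* n)))))

  -- A shortest word exists classically, which suffices to refute a minimality claim.
  no-shorter : ∀ (x : C̃ n) {v m} → v ≈ x → length v ℕ.< m → ¬ (∀ l → HasLength x l → m ℕ.≤ l)
  no-shorter x {v} {m} v≈x v<m minimal = go v (<-wellFounded (length v)) v≈x v<m
    where
    go : ∀ v → Acc ℕ._<_ (length v) → v ≈ x → ¬ length v ℕ.< m
    go v (acc rec) v≈x v<m = ℕ.<⇒≱ v<m (minimal (length v) ((v , v≈x , refl) ,
      λ u u≈x → ℕ.≮⇒≥ λ u<v → go u (rec u<v) u≈x (ℕ.<-trans u<v v<m)))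

  -- At a descent, `exchange` deletes a letter from a shortest word of `w` and yields a shorter word
  -- in the coset, against minimality.
  grassmannian-ascending : .{{_ : NonZero n}} → ∀ (w : C̃ n) → AffineGrassmannian w → Ascending w
  grassmannian-ascending w (m , ((v , v≈w , len) , _) , minimal) with ascending⊎descent w
  ... | inj₁ asc = asc
  ... | inj₂ (i , i≢0 , desc) =
    let v≗w = ≈⇒act {v = v} {w} v≈w
        v′ , _ , len′ , eq = exchange v (letter-transposes i (hit⁺ (≅-reflexive refl)))
            (k-1<k (+ toℕ i))
          (subst₂ _<_ (sym (v≗w _)) (sym (v≗w _)) desc)
        v′≈wi = act⇒≈ {v = v′} {w ++ i ∷ []} λ k →
            trans (eq k) (trans (v≗w (σ i k)) (sym (act-++ w (i ∷ []) k)))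
    in ⊥-elim (no-shorter (w ++ i ∷ []) {v′} v′≈wi (ℕ.≤-reflexive (trans len′ len))
         (λ l → minimal (i ∷ []) (i≢0 ∷ []) l))

-- Partitions through their rows; corners

part-zero : ∀ xs → part xs 0 ≡ 0
part-zero []      = refl
part-zero (_ ∷ _) = refl

part-decreasing : ∀ {xs} → Linked _≥_ xs → ∀ r → part xs (2 ℕ.+ r) ℕ.≤ part xs (suc r)
part-decreasing []           r       = ℕ.z≤n
part-decreasing [-]          r       = ℕ.z≤n
part-decreasing (x≥y ∷ _)    zero    = x≥y
part-decreasing (_ ∷ linked) (suc r) = part-decreasing linked r

part-vanishes : ∀ xs r → length xs ℕ.≤ r → part xs (suc r) ≡ 0
part-vanishes []       r       _           = refl
part-vanishes (x ∷ xs) (suc r) (ℕ.s≤s len) = part-vanishes xs r len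

Antitone : (ℕ → ℕ) → Set
Antitone f = ∀ r → f (suc r) ℕ.≤ f r

antitone-zero : ∀ {f} → Antitone f → f 0 ≡ 0 → ∀ r → f r ≡ 0
antitone-zero anti f0 zero        = f0
antitone-zero {f} anti f0 (suc r) =
  ℕ.n≤0⇒n≡0 (subst (f (suc r) ℕ.≤_) (antitone-zero anti f0 r) (anti r))

-- A zero row ends the list: `positive` forbids zero parts, and in an antitone sequence only zeros
-- follow.
cons : ℕ → List ℕ → List ℕ
cons zero    xs = []
cons (suc x) xs = suc x ∷ xs

fromRows : (ℕ → ℕ) → ℕ → List ℕ
fromRows f zero    = []
fromRows f (suc R) = cons (f 0) (fromRows (f ∘ suc) R)

fromRows-part : ∀ {f} → Antitone f → ∀ R → (∀ r → R ℕ.≤ r → f r ≡ 0) →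
                ∀ r → part (fromRows f R) (suc r) ≡ f r
fromRows-part anti zero    vanish r = sym (vanish r ℕ.z≤n)
fromRows-part {f} anti (suc R) vanish r = go (f 0) refl r
  where
  go : ∀ x → f 0 ≡ x → ∀ r → part (cons x (fromRows (f ∘ suc) R)) (suc r) ≡ f r
  go zero    f0 r       = sym (antitone-zero anti f0 r)
  go (suc x) f0 zero    = sym f0
  go (suc x) f0 (suc r) = fromRows-part (anti ∘ suc) R (λ s R≤s → vanish (suc s) (ℕ.s≤s R≤s)) r

cons-linked : ∀ {x xs} → part xs 1 ℕ.≤ x → Linked _≥_ xs → Linked _≥_ (cons x xs)
cons-linked {zero}           _   _      = []
cons-linked {suc x} {[]}     _   _      = [-]
cons-linked {suc x} {y ∷ ys} y≤x linked = y≤x ∷ linked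

fromRows-linked : ∀ {f} → Antitone f → ∀ R → (∀ r → R ℕ.≤ r → f r ≡ 0) → Linked _≥_ (fromRows f R)
fromRows-linked         anti zero    vanish = []
fromRows-linked {f} anti (suc R) vanish = cons-linked
  (subst (ℕ._≤ f 0) (sym (fromRows-part (anti ∘ suc) R vanish′ 0)) (anti 0))
  (fromRows-linked (anti ∘ suc) R vanish′)
  where
  vanish′ : ∀ r → R ℕ.≤ r → f (suc r) ≡ 0
  vanish′ r R≤r = vanish (suc r) (ℕ.s≤s R≤r)

cons-positive : ∀ x {xs} → All (0 ℕ.<_) xs → All (0 ℕ.<_) (cons x xs)
cons-positive zero    _  = []
cons-positive (suc x) ps = ℕ.s≤s ℕ.z≤n ∷ ps

fromRows-positive : ∀ f R → All (0 ℕ.<_) (fromRows f R)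
fromRows-positive f zero    = []
fromRows-positive f (suc R) = cons-positive (f 0) (fromRows-positive (f ∘ suc) R)

row : Partition → ℕ → ℕ
row μ = part (parts μ)

-- Supplies the partition ν that `Addable` and `Removable` ask for, as these change `μ` in one row
-- only.
setRow : ∀ μ r x → row μ (2 ℕ.+ r) ℕ.≤ x → (∀ s → r ≡ suc s → x ℕ.≤ row μ (suc s)) →
  ∃ λ ν → row ν (suc r) ≡ x × (∀ s → s ≢ r → row ν (suc s) ≡ row μ (suc s))
setRow μ r x below above = record
  { parts = fromRows f R ; decreasing = fromRows-linked anti R vanish ; positive = fromRows-positive
      f R }
  , trans (fromRows-part anti R vanish r) f-r
  , λ s s≢r → trans (fromRows-part anti R vanish s) (f-s s s≢r)
  where
  f : ℕ → ℕ
  f s = if does (s ℕ.≟ r) then x else row μ (suc s)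
  -- Enough rows for the changed one and for all parts of `μ`.
  R : ℕ
  R = suc r ℕ.+ length (parts μ)
  f-r : f r ≡ x
  f-r = cong (λ b → if b then x else row μ (suc r)) (dec-true (r ℕ.≟ r) refl)
  f-s : ∀ s → s ≢ r → f s ≡ row μ (suc s)
  f-s s s≢r = cong (λ b → if b then x else row μ (suc s)) (dec-false (s ℕ.≟ r) s≢r)
  vanish : ∀ s → R ℕ.≤ s → f s ≡ 0
  vanish s R≤s = trans (f-s s λ { refl → ℕ.<⇒≱ (ℕ.≤-trans (ℕ.m≤m+n (suc s) _) R≤s) ℕ.≤-refl })
    (part-vanishes (parts μ) s (ℕ.≤-trans (ℕ.m≤n+m _ (suc r)) R≤s))
  anti : Antitone f
  anti s = by-cases (suc s ℕ.≟ r) (s ℕ.≟ r)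
    where
    by-cases : Dec (suc s ≡ r) → Dec (s ≡ r) → f (suc s) ℕ.≤ f s
    by-cases (yes refl) (yes ())
    by-cases (yes refl) (no s≢r) = subst₂ ℕ._≤_ (sym f-r) (sym (f-s s s≢r)) (above s refl)
    by-cases (no s≢r) (yes refl) = subst₂ ℕ._≤_ (sym (f-s (suc s) s≢r)) (sym f-r) below
    by-cases (no s+1≢r) (no s≢r) = subst₂ ℕ._≤_ (sym (f-s (suc s) s+1≢r)) (sym (f-s s s≢r))
      (part-decreasing (decreasing μ) s)

dg-1≤row : ∀ μ {r c} → (r , c) ∈ dg μ → 1 ℕ.≤ r
dg-1≤row μ {zero}  (1≤c , c≤) = ⊥-elim
    (ℕ.<⇒≱ 1≤c (ℕ.≤-trans c≤ (ℕ.≤-reflexive (part-zero (parts μ)))))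
dg-1≤row μ {suc r} _          = ℕ.s≤s ℕ.z≤n

dg-south : ∀ μ {r c} → 1 ℕ.≤ r → (suc r , c) ∈ dg μ → (r , c) ∈ dg μ
dg-south μ {suc r} _ (1≤c , c≤) = 1≤c , ℕ.≤-trans c≤ (part-decreasing (decreasing μ) r)

dg-west : ∀ μ {r c} → 1 ℕ.≤ c → (r , suc c) ∈ dg μ → (r , c) ∈ dg μ
dg-west μ 1≤c (_ , c<) = 1≤c , ℕ.<⇒≤ c<

dg? : ∀ μ b → Dec (b ∈ dg μ)
dg? μ (r , c) = (1 ℕ.≤? c) ×-dec (c ℕ.≤? row μ r)

addable : ∀ μ r c → (suc r , suc c) ∉ dg μ → (1 ℕ.≤ r → (r , suc c) ∈ dg μ) →
  (1 ℕ.≤ c → (suc r , c) ∈ dg μ) → Addable μ (suc r , suc c)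
addable μ r c ∉μ south west =
  let ν , ν-r , ν-s = setRow μ r (suc c)
        (ℕ.≤-trans (part-decreasing (decreasing μ) r) (ℕ.≤-trans (ℕ.≤-reflexive row-r) (ℕ.n≤1+n c)))
                        (λ { s refl → proj₂ (south (ℕ.s≤s ℕ.z≤n)) })
  in ∉μ , ν ,
     (λ { {zero , d} p → ⊥-elim (ℕ.<⇒≱ (dg-1≤row ν p) ℕ.z≤n)
        ; {suc s , d} (1≤d , d≤) → to ν ν-r ν-s s d 1≤d d≤ (s ℕ.≟ r) }) ,
     (λ { {zero , d} (inj₁ p) → ⊥-elim (ℕ.<⇒≱ (dg-1≤row μ p) ℕ.z≤n)
        ; {suc s , d} (inj₁ (1≤d , d≤)) → 1≤d , from ν ν-r ν-s s d d≤ (s ℕ.≟ r)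
        ; (inj₂ refl) → ℕ.s≤s ℕ.z≤n , ℕ.≤-reflexive (sym ν-r) })
  where
  c≤row : ∀ c → (1 ℕ.≤ c → (suc r , c) ∈ dg μ) → c ℕ.≤ row μ (suc r)
  c≤row zero    _    = ℕ.z≤n
  c≤row (suc c) west = proj₂ (west (ℕ.s≤s ℕ.z≤n))
  row-r : row μ (suc r) ≡ c
  row-r = ℕ.≤-antisym (ℕ.≮⇒≥ λ c< → ∉μ (ℕ.s≤s ℕ.z≤n , c<)) (c≤row c west)
  to : ∀ ν → row ν (suc r) ≡ suc c → (∀ s → s ≢ r → row ν (suc s) ≡ row μ (suc s)) →
       ∀ s d → 1 ℕ.≤ d → d ℕ.≤ row ν (suc s) → Dec (s ≡ r) →
       (suc s , d) ∈ dg μ ⊎ (suc r , suc c) ≡ (suc s , d)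
  to ν ν-r ν-s s d 1≤d d≤ (no s≢r) = inj₁ (1≤d , subst (d ℕ.≤_) (ν-s s s≢r) d≤)
  to ν ν-r ν-s s d 1≤d d≤ (yes refl) with ℕ.m≤n⇒m<n∨m≡n (subst (d ℕ.≤_) ν-r d≤)
  ... | inj₁ (ℕ.s≤s d≤c) = inj₁ (1≤d , ℕ.≤-trans d≤c (ℕ.≤-reflexive (sym row-r)))
  ... | inj₂ refl        = inj₂ refl
  from : ∀ ν → row ν (suc r) ≡ suc c → (∀ s → s ≢ r → row ν (suc s) ≡ row μ (suc s)) →
         ∀ s d → d ℕ.≤ row μ (suc s) → Dec (s ≡ r) → d ℕ.≤ row ν (suc s)
  from ν ν-r ν-s s d d≤ (no s≢r)   = subst (d ℕ.≤_) (sym (ν-s s s≢r)) d≤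
  from ν ν-r ν-s s d d≤ (yes refl) = ℕ.≤-trans d≤
      (ℕ.≤-trans (ℕ.≤-reflexive row-r) (ℕ.≤-trans (ℕ.n≤1+n c) (ℕ.≤-reflexive (sym ν-r))))

removable : ∀ μ r c → (suc r , suc c) ∈ dg μ → (2 ℕ.+ r , suc c) ∉ dg μ → (suc r , 2 ℕ.+ c) ∉ dg μ →
  Removable μ (suc r , suc c)
removable μ r c ∈μ north east =
  let ν , ν-r , ν-s = setRow μ r c (ℕ.≮⇒≥ λ c< → north (ℕ.s≤s ℕ.z≤n , c<))
        (λ { s refl → ℕ.≤-trans (ℕ.n≤1+n c)
            (ℕ.≤-trans (proj₂ ∈μ) (part-decreasing (decreasing μ) s)) })
  in ∈μ , ν ,
     (λ { {zero , d} p → ⊥-elim (ℕ.<⇒≱ (dg-1≤row ν p) ℕ.z≤n)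
        ; {suc s , d} (1≤d , d≤) → to ν ν-r ν-s s d 1≤d d≤ (s ℕ.≟ r) }) ,
     (λ { {zero , d} (p , _) → ⊥-elim (ℕ.<⇒≱ (dg-1≤row μ p) ℕ.z≤n)
        ; {suc s , d} ((1≤d , d≤) , ≢b) → 1≤d , from ν ν-r ν-s s d d≤ ≢b (s ℕ.≟ r) })
  where
  row-r : row μ (suc r) ≡ suc c
  row-r = ℕ.≤-antisym (ℕ.≮⇒≥ λ c< → east (ℕ.s≤s ℕ.z≤n , c<)) (proj₂ ∈μ)
  to : ∀ ν → row ν (suc r) ≡ c → (∀ s → s ≢ r → row ν (suc s) ≡ row μ (suc s)) →
       ∀ s d → 1 ℕ.≤ d → d ℕ.≤ row ν (suc s) → Dec (s ≡ r) →
       (suc s , d) ∈ dg μ × (suc r , suc c) ≢ (suc s , d)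
  to ν ν-r ν-s s d 1≤d d≤ (no s≢r) = (1≤d , subst (d ℕ.≤_) (ν-s s s≢r) d≤) , λ { refl → s≢r refl }
  to ν ν-r ν-s s d 1≤d d≤ (yes refl) =
    (1≤d , ℕ.≤-trans d≤c (ℕ.≤-trans (ℕ.n≤1+n c) (ℕ.≤-reflexive (sym row-r)))) ,
        λ { refl → ℕ.<⇒≱ d≤c ℕ.≤-refl }
    where
    d≤c : d ℕ.≤ c
    d≤c = subst (d ℕ.≤_) ν-r d≤
  from : ∀ ν → row ν (suc r) ≡ c → (∀ s → s ≢ r → row ν (suc s) ≡ row μ (suc s)) →
         ∀ s d → d ℕ.≤ row μ (suc s) → (suc r , suc c) ≢ (suc s , d) → Dec (s ≡ r) →
             d ℕ.≤ row ν (suc s)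
  from ν ν-r ν-s s d d≤ ≢b (no s≢r) = subst (d ℕ.≤_) (sym (ν-s s s≢r)) d≤
  from ν ν-r ν-s s d d≤ ≢b (yes refl) =
    ℕ.≤-trans (ℕ.s≤s⁻¹ (ℕ.≤∧≢⇒< (subst (d ℕ.≤_) row-r d≤) λ { refl → ≢b refl }))
        (ℕ.≤-reflexive (sym ν-r))

-- Corners as bends of the profile

content-south : ∀ r c → content (r , c) ≡ content (suc r , c) + 1ℤ
content-south r c = solve 2 (λ r c → c :- r := c :- (con 1ℤ :+ r) :+ con 1ℤ) refl (+ r) (+ c)

content-north : ∀ r c → content (suc r , c) ≡ content (r , c) - 1ℤ
content-north r c = solve 2 (λ r c → c :- (con 1ℤ :+ r) := c :- r :- con 1ℤ) refl (+ r) (+ c)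

content-east : ∀ r c → content (r , suc c) ≡ content (r , c) + 1ℤ
content-east r c = solve 2 (λ r c → con 1ℤ :+ c :- r := c :- r :+ con 1ℤ) refl (+ r) (+ c)

content-west : ∀ r c → content (r , c) ≡ content (r , suc c) - 1ℤ
content-west r c = solve 2 (λ r c → c :- r := con 1ℤ :+ c :- r :- con 1ℤ) refl (+ r) (+ c)

-- On diagonal k, row ρ + 1 meets column k + ρ + 1. The two bounds, which every profile satisfies,
-- make both indices positive.
box-at : ∀ k ρ → 0ℤ ≤ ρ → - k ≤ ρ → ∃ λ r → ∃ λ c → content (suc r , suc c) ≡ k × + suc r ≡ ρ + 1ℤ
box-at k ρ 0≤ρ -k≤ρ = ∣ ρ ∣ , ∣ k + ρ ∣ ,
  trans (cong₂ (λ c r → 1ℤ + c - (1ℤ + r)) (ℤ.0≤i⇒+∣i∣≡i 0≤k+ρ) (ℤ.0≤i⇒+∣i∣≡i 0≤ρ))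
    (solve 2 (λ k r → con 1ℤ :+ (k :+ r) :- (con 1ℤ :+ r) := k) refl k ρ) ,
  trans (cong (_+_ 1ℤ) (ℤ.0≤i⇒+∣i∣≡i 0≤ρ)) (ℤ.+-comm 1ℤ ρ)
  where
  0≤k+ρ : 0ℤ ≤ k + ρ
  0≤k+ρ = ≤-gap -k≤ρ (solve 2 (λ k r → r :- (:- k) := k :+ r :- con 0ℤ) refl k ρ)

≰-+1 : ∀ {x} → ¬ x + 1ℤ ≤ x
≰-+1 {x} le = ℤ.<-irrefl refl (+1≤⇒< le)

module _ {n : ℕ} where

  -- A vertical step before a horizontal one leaves room for an addable corner of content k, in row
  -- `profile w k + 1ℤ`. In a `Peak` the types are reversed and a removable corner sits in row
  -- `profile w k`.
  record Valley (w : C̃ n) (k : ℤ) : Set where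
    field
      left<0  : act⁻¹ w (k - 1ℤ) < 0ℤ
      right≥0 : 0ℤ ≤ act⁻¹ w k
      left    : profile w (k - 1ℤ) ≡ profile w k + 1ℤ
      right   : profile w k ≡ profile w (k + 1ℤ)

  record Peak (w : C̃ n) (k : ℤ) : Set where
    field
      left≥0  : 0ℤ ≤ act⁻¹ w (k - 1ℤ)
      right<0 : act⁻¹ w k < 0ℤ
      left    : profile w (k - 1ℤ) ≡ profile w k
      right   : profile w k ≡ profile w (k + 1ℤ) + 1ℤ

  data Bend (w : C̃ n) (k : ℤ) : Set where
    valley   : Valley w k → Bend w k
    peak     : Peak w k → Bend w k
    straight : profile w (k - 1ℤ) - profile w k ≡ profile w k - profile w (k + 1ℤ) → Bend w k

  bend : ∀ w k → Bend w k
  bend w k with step-1 w k | step w k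
  ... | vertical a p   | horizontal b q = valley record
      { left<0 = a ; right≥0 = b ; left = p ; right = q }
  ... | horizontal a p | vertical b q   = peak record
      { left≥0 = a ; right<0 = b ; left = p ; right = q }
  ... | vertical _ p   | vertical _ q   = straight (trans (cong (_- profile w k) p)
      (trans (solve 2 (λ a b → a :+ con 1ℤ :- a := b :+ con 1ℤ :- b) refl (profile w k)
          (profile w (k + 1ℤ)))
        (cong (_- profile w (k + 1ℤ)) (sym q))))
  ... | horizontal _ p | horizontal _ q = straight (trans (cong (_- profile w k) p)
      (trans (solve 2 (λ a b → a :- a := b :- b) refl (profile w k) (profile w (k + 1ℤ)))
        (cong (_- profile w (k + 1ℤ)) (sym q))))

  -- A step drops the profile by 0 or 1, so an inequality on each side already fixes the types of
  -- both steps.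
  valley-≤ : ∀ w k → profile w k + 1ℤ ≤ profile w (k - 1ℤ) → profile w k ≤ profile w (k + 1ℤ) →
      Valley w k
  valley-≤ w k le₁ le₂ with step-1 w k | step w k
  ... | vertical a p   | horizontal b q = record { left<0 = a ; right≥0 = b ; left = p ; right = q }
  ... | horizontal _ p | _              = ⊥-elim (≰-+1 (subst (profile w k + 1ℤ ≤_) p le₁))
  ... | vertical _ _   | vertical _ q   = ⊥-elim (≰-+1 (subst (_≤ profile w (k + 1ℤ)) q le₂))

  peak-≤ : ∀ w k → profile w (k - 1ℤ) ≤ profile w k → profile w (k + 1ℤ) + 1ℤ ≤ profile w k →
      Peak w k
  peak-≤ w k le₁ le₂ with step-1 w k | step w k
  ... | horizontal a p | vertical b q   = record { left≥0 = a ; right<0 = b ; left = p ; right = q }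
  ... | vertical _ p   | _              = ⊥-elim (≰-+1 (subst (_≤ profile w k) p le₁))
  ... | horizontal _ _ | horizontal _ q = ⊥-elim (≰-+1 (subst (profile w (k + 1ℤ) + 1ℤ ≤_) q le₂))

  private
    -k-1 : ∀ k → - k - 1ℤ ≡ mirror k
    -k-1 = solve 1 (λ k → :- k :- con 1ℤ := con -1ℤ :- k) refl

    -k : ∀ k → - k ≡ mirror (k - 1ℤ)
    -k = solve 1 (λ k → :- k := con -1ℤ :- (k :- con 1ℤ)) refl

    mirror-≥0 : ∀ {x} → x < 0ℤ → 0ℤ ≤ mirror x
    mirror-≥0 {x} x<0 = ≤-gap (<⇒+1≤ x<0)
        (solve 1 (λ x → con 0ℤ :- (x :+ con 1ℤ) := con -1ℤ :- x :- con 0ℤ) refl x)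

    mirror-<0 : ∀ {x} → 0ℤ ≤ x → mirror x < 0ℤ
    mirror-<0 {x} 0≤x = +1≤⇒<
        (≤-gap 0≤x (solve 1 (λ x → x :- con 0ℤ := con 0ℤ :- (con -1ℤ :- x :+ con 1ℤ)) refl x))

  -- The mirror reverses the order of the two steps and exchanges their types, so vertical before
  -- horizontal is preserved. This turns a diagonal congruent to -i into one congruent to i.
  mirror-valley : ∀ w {k} → Valley w k → Valley w (- k)
  mirror-valley w {k} V with step-1 w (- k) | step w (- k)
  ... | vertical a p   | horizontal b q = record { left<0 = a ; right≥0 = b ; left = p ; right = q }
  ... | horizontal a _ | _              = ⊥-elim (ℤ.<⇒≱ (mirror-<0 (Valley.right≥0 V))
      (subst (0ℤ ≤_) (trans (cong (act⁻¹ w) (-k-1 k)) (eq-mirror (act⁻¹-equivariant w) k)) a))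
  ... | vertical _ _   | vertical b _   = ⊥-elim (ℤ.<⇒≱ b
      (subst (0ℤ ≤_) (sym (trans (cong (act⁻¹ w) (-k k))
          (eq-mirror (act⁻¹-equivariant w) (k - 1ℤ)))) (mirror-≥0 (Valley.left<0 V))))

  mirror-peak : ∀ w {k} → Peak w k → Peak w (- k)
  mirror-peak w {k} P with step-1 w (- k) | step w (- k)
  ... | horizontal a p | vertical b q   = record { left≥0 = a ; right<0 = b ; left = p ; right = q }
  ... | vertical a _   | _              = ⊥-elim (ℤ.<⇒≱ a
      (subst (0ℤ ≤_) (sym (trans (cong (act⁻¹ w) (-k-1 k)) (eq-mirror (act⁻¹-equivariant w) k)))
          (mirror-≥0 (Peak.right<0 P))))
  ... | horizontal _ _ | horizontal b _ = ⊥-elim (ℤ.<⇒≱ (mirror-<0 (Peak.left≥0 P))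
      (subst (0ℤ ≤_) (trans (cong (act⁻¹ w) (-k k)) (eq-mirror (act⁻¹-equivariant w) (k - 1ℤ))) b))

  record Represents (w : C̃ n) (μ : Partition) : Set where
    field
      below  : ∀ {r c} → (suc r , suc c) ∈ dg μ → + suc r ≤ profile w (content (suc r , suc c))
      inside : ∀ {r c} → + suc r ≤ profile w (content (suc r , suc c)) → (suc r , suc c) ∈ dg μ

    above : ∀ {r c} → (suc r , suc c) ∉ dg μ → profile w (content (suc r , suc c)) < + suc r
    above ∉μ = ℤ.≰⇒> (∉μ ∘ inside)

  module _ {w : C̃ n} {μ : Partition} (R : Represents w μ) where

    open Represents R

    -- The box lies outside and its south and west neighbours inside; at an edge of the quadrant
    -- `profile-≥0` or `profile-≥-` stands in for the missing neighbour. This pins down the profile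
    -- on both sides of k.
    addable⇒valley : ∀ {r c} → Addable μ (suc r , suc c) →
      Valley w (content (suc r , suc c)) × + suc r ≡ profile w (content (suc r , suc c)) + 1ℤ
    addable⇒valley {r} {c} (∉μ , ν , ν⊆ , ⊆ν) =
      valley-≤ w k (ℤ.≤-trans p+1≤r+1 (west c refl)) p≤p₊₁ ,
      ℤ.≤-antisym (≤-gap (ℤ.≤-trans (south r refl) (step-≤ (step w k)))
        (solve 2 (λ p r → p :- r := p :+ con 1ℤ :- (con 1ℤ :+ r)) refl (profile w k) (+ r))) p+1≤r+1
      where
      k : ℤ
      k = content (suc r , suc c)
      p+1≤r+1 : profile w k + 1ℤ ≤ + suc r
      p+1≤r+1 = <⇒+1≤ (above ∉μ)
      b∈ν : (suc r , suc c) ∈ dg ν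
      b∈ν = ⊆ν (inj₂ refl)
      south : ∀ r′ → r ≡ r′ → + r′ ≤ profile w (k + 1ℤ)
      south zero     _    = profile-≥0 w (k + 1ℤ)
      south (suc r′) refl with ν⊆ (dg-south ν (ℕ.s≤s ℕ.z≤n) b∈ν)
      ... | inj₁ ∈μ = subst (λ l → + r ≤ profile w l) (content-south r (suc c)) (below ∈μ)
      west : ∀ c′ → c ≡ c′ → + suc r ≤ profile w (k - 1ℤ)
      west zero     refl = subst (_≤ profile w (k - 1ℤ))
        (solve 1 (λ r → :- (con (+ 1) :- (con 1ℤ :+ r) :- con 1ℤ) := con 1ℤ :+ r) refl (+ r))
        (profile-≥- w (k - 1ℤ))
      west (suc c′) refl with ν⊆ (dg-west ν (ℕ.s≤s ℕ.z≤n) b∈ν)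
      ... | inj₁ ∈μ = subst (λ l → + suc r ≤ profile w l) (content-west (suc r) c) (below ∈μ)
      p≤p₊₁ : profile w k ≤ profile w (k + 1ℤ)
      p≤p₊₁ = ≤-gap₂ p+1≤r+1 (south r refl)
        (solve 3 (λ p r q → (con 1ℤ :+ r :- (p :+ con 1ℤ)) :+ (q :- r) := q :- p) refl
          (profile w k) (+ r) (profile w (k + 1ℤ)))

    valley⇒addable : ∀ {r c} → Valley w (content (suc r , suc c)) →
      + suc r ≡ profile w (content (suc r , suc c)) + 1ℤ → Addable μ (suc r , suc c)
    valley⇒addable {r} {c} V r+1≡ = addable μ r c
      (λ ∈μ → ≰-+1 (subst (_≤ profile w (content (suc r , suc c))) r+1≡ (below ∈μ)))
      (south r refl) (west c refl)
      where
      south : ∀ r′ → r ≡ r′ → 1 ℕ.≤ r → (r , suc c) ∈ dg μ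
      south (suc r′) refl _ = inside
          (subst (λ l → + r ≤ profile w l) (sym (content-south r (suc c)))
        (subst (+ r ≤_) (Valley.right V) (ℤ.≤-reflexive (trans (sym (+1-1 (+ r)))
          (trans (cong (_- 1ℤ) (trans (ℤ.+-comm (+ r) 1ℤ) r+1≡)) (+1-1 _))))))
      west : ∀ c′ → c ≡ c′ → 1 ℕ.≤ c → (suc r , c) ∈ dg μ
      west (suc c′) refl _ = inside
          (subst (λ l → + suc r ≤ profile w l) (sym (content-west (suc r) c))
        (ℤ.≤-reflexive (trans r+1≡ (sym (Valley.left V)))))

    removable⇒peak : ∀ {r c} → Removable μ (suc r , suc c) →
      Peak w (content (suc r , suc c)) × + suc r ≡ profile w (content (suc r , suc c))
    removable⇒peak {r} {c} (∈μ , ν , ν⊆ , ⊆ν) =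
      peak-≤ w k (ℤ.≤-trans north (below ∈μ)) (ℤ.≤-trans east (below ∈μ)) ,
      ℤ.≤-antisym (below ∈μ) (ℤ.≤-trans (step-≤ (step-1 w k)) north)
      where
      k : ℤ
      k = content (suc r , suc c)
      b∉ν : (suc r , suc c) ∉ dg ν
      b∉ν b∈ν = proj₂ (ν⊆ b∈ν) refl
      north : profile w (k - 1ℤ) ≤ + suc r
      north = ≤-gap (<⇒+1≤ (subst (λ l → profile w l < + (2 ℕ.+ r)) (content-north (suc r) (suc c))
          (above λ ∈μ′ → b∉ν (dg-south ν (ℕ.s≤s ℕ.z≤n) (⊆ν (∈μ′ , λ ()))))))
        (solve 2 (λ p r → con (+ 2) :+ r :- (p :+ con 1ℤ) := con 1ℤ :+ r :- p) refl
            (profile w (k - 1ℤ)) (+ r))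
      east : profile w (k + 1ℤ) + 1ℤ ≤ + suc r
      east = <⇒+1≤ (subst (λ l → profile w l < + suc r) (content-east (suc r) (suc c))
          (above λ ∈μ′ → b∉ν (dg-west ν (ℕ.s≤s ℕ.z≤n) (⊆ν (∈μ′ , λ ())))))

    peak⇒removable : ∀ {r c} → Peak w (content (suc r , suc c)) →
      + suc r ≡ profile w (content (suc r , suc c)) → Removable μ (suc r , suc c)
    peak⇒removable {r} {c} P r+1≡ = removable μ r c (inside (ℤ.≤-reflexive r+1≡))
      (λ ∈μ → ≰-+1 (subst₂ _≤_ (ℤ.+-comm 1ℤ (+ suc r))
          (trans (cong (profile w) (content-north (suc r) (suc c)))
        (trans (Peak.left P) (sym r+1≡))) (below ∈μ)))
      (λ ∈μ → ≰-+1 (subst₂ _≤_ (trans r+1≡ (Peak.right P))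
          (cong (profile w) (content-east (suc r) (suc c))) (below ∈μ)))

-- The action on cores reflects profiles

module _ {n : ℕ} where

  residue±⇒hit : ∀ {i : Fin (suc n)} b → b ∈ Residue± n i → Hit i (content b)
  residue±⇒hit     b (inj₁ p) = hit⁺ (fromMod p)
  residue±⇒hit {i} b (inj₂ p) = hit⁻ (≅-trans (fromMod p)
    (by 1ℤ (solve 2 (λ m j → m :- j := :- j :+ con 1ℤ :* m) refl (+ (2 ℕ.* n)) (+ toℕ i))))

  hit⇒residue± : ∀ {i : Fin (suc n)} b → Hit i (content b) → b ∈ Residue± n i
  hit⇒residue±     b (hit⁺ p) = inj₁ (toMod p)
  hit⇒residue± {i} b (hit⁻ p) = inj₂ (toMod (≅-trans p
    (by -1ℤ (solve 2 (λ m j → :- j := m :- j :+ con -1ℤ :* m) refl (+ (2 ℕ.* n)) (+ toℕ i)))))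

  module _ (i : Fin (suc n)) (w : C̃ n) {k : ℤ} (h : Hit i k) where

    profile-valley : Valley w k → profile (i ∷ w) k ≡ profile w k + 1ℤ
    profile-valley V = trans (profile-hit i w h) (trans
      (cong₂ (λ a b → a + b - profile w k) (Valley.left V) (sym (Valley.right V)))
      (solve 1 (λ p → p :+ con 1ℤ :+ p :- p := p :+ con 1ℤ) refl (profile w k)))

    profile-peak : Peak w k → profile (i ∷ w) k + 1ℤ ≡ profile w k
    profile-peak P = trans (cong (_+ 1ℤ) (trans (profile-hit i w h)
        (cong (λ a → a + profile w (k + 1ℤ) - profile w k) (Peak.left P))))
      (trans (solve 2 (λ p q → p :+ q :- p :+ con 1ℤ := q :+ con 1ℤ) refl (profile w k)
          (profile w (k + 1ℤ)))
        (sym (Peak.right P)))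

    profile-straight : profile w (k - 1ℤ) - profile w k ≡ profile w k - profile w (k + 1ℤ) →
      profile (i ∷ w) k ≡ profile w k
    profile-straight eq = trans (profile-hit i w h) (trans
      (solve 3 (λ a p b → a :+ b :- p := (a :- p) :+ b) refl (profile w (k - 1ℤ)) (profile w k)
          (profile w (k + 1ℤ)))
      (trans (cong (_+ profile w (k + 1ℤ)) eq)
        (solve 2 (λ p b → p :- b :+ b := p) refl (profile w k) (profile w (k + 1ℤ)))))

  module _ {i : Fin (suc n)} {w : C̃ n} {κ κ′ : SymmetricCore n}
           (R : Represents w (partition κ)) (act : GenAction i κ κ′) where

    open Represents R
    open GenAction act

    -- `AddableAt` asks for residue i itself, so a valley on a diagonal congruent to -i is first
    -- mirrored.
    valley⇒addableAt : ∀ {k} → Hit i k → Valley w k → ∃ (AddableAt κ i)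
    valley⇒addableAt {k} (hit⁻ p) V = valley⇒addableAt (hit⁺ (≅-flip p)) (mirror-valley w V)
    valley⇒addableAt {k} (hit⁺ p) V with box-at k (profile w k) (profile-≥0 w k) (profile-≥- w k)
    ... | r , c , refl , r≡ = (suc r , suc c) , valley⇒addable R V r≡ , toMod p

    peak⇒removableAt : ∀ {k} → Hit i k → Peak w k → ∃ (RemovableAt κ i)
    peak⇒removableAt {k} (hit⁻ p) P = peak⇒removableAt (hit⁺ (≅-flip p)) (mirror-peak w P)
    -- The corner lies in row `profile w k`, and at a peak this is `profile w (k + 1ℤ)` plus 1.
    peak⇒removableAt {k} (hit⁺ p) P with box-at k (profile w (k + 1ℤ)) (profile-≥0 w (k + 1ℤ))
      (≤-gap (subst (- (k - 1ℤ) ≤_) (trans (Peak.left P) (Peak.right P)) (profile-≥- w (k - 1ℤ)))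
        (solve 2 (λ k q → q :+ con 1ℤ :- (:- (k :- con 1ℤ)) := q :- (:- k)) refl k
            (profile w (k + 1ℤ))))
    ... | r , c , refl , r≡ = (suc r , suc c) , peak⇒removable R P (trans r≡ (sym (Peak.right P))) ,
        toMod p

    private
      Goal : ℕ → ℕ → Set
      Goal r c = ((suc r , suc c) ∈ diagram κ′ →
          + suc r ≤ profile (i ∷ w) (content (suc r , suc c))) ×
                 (+ suc r ≤ profile (i ∷ w) (content (suc r , suc c)) →
                     (suc r , suc c) ∈ diagram κ′)

    -- A single valley at residue i makes `i` rise for `w`, so the profile decreases nowhere; it
    -- grows exactly at the hit valleys, by the one box that is the added corner.
    when-adding : ∃ (AddableAt κ i) → ∀ r c → Goal r c
    when-adding (b₀ , addable₀ , residue₀) r c = to , from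
      where
      a = b₀ , addable₀ , residue₀
      k = content (suc r , suc c)
      V₀ : Valley w (content b₀)
      V₀ = on-box b₀ addable₀
        where
        on-box : ∀ b → Addable (partition κ) b → Valley w (content b)
        on-box (zero , c) (_ , ν , _ , ⊆ν) = ⊥-elim (ℕ.<⇒≱ (dg-1≤row ν (⊆ν (inj₂ refl))) ℕ.z≤n)
        on-box (suc r , zero) (_ , ν , _ , ⊆ν) = ⊥-elim (ℕ.<⇒≱ (proj₁ (⊆ν (inj₂ refl))) ℕ.z≤n)
        on-box (suc r , suc c) add = proj₁ (addable⇒valley R add)
      p≤ : profile w k ≤ profile (i ∷ w) k
      p≤ = profile-rises {i = i} {w} (rises {w = w} (hit⁺ (fromMod residue₀))
             (ℤ.<-≤-trans (Valley.left<0 V₀) (Valley.right≥0 V₀))) k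
      to : (suc r , suc c) ∈ diagram κ′ → + suc r ≤ profile (i ∷ w) k
      to b∈κ′ with proj₁ (adding a) b∈κ′
      ... | inj₁ b∈κ = ℤ.≤-trans (below b∈κ) p≤
      ... | inj₂ (add , res) = let V , r≡ = addable⇒valley R add in
        ℤ.≤-reflexive (trans r≡ (sym (profile-valley i w (residue±⇒hit (suc r , suc c) res) V)))
      bent : Hit i k → Bend w k → + suc r ≤ profile (i ∷ w) k → (suc r , suc c) ∈ diagram κ′
      bent h (valley V) r≤ with + suc r ℤ.≤? profile w k
      ... | yes r≤p = proj₂ (adding a) (inj₁ (inside r≤p))
      ... | no r≰p  = proj₂ (adding a) (inj₂ (valley⇒addable R V (ℤ.≤-antisym
        (subst (+ suc r ≤_) (profile-valley i w h V) r≤) (<⇒+1≤ (ℤ.≰⇒> r≰p))) , hit⇒residue±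
            (suc r , suc c) h))
      bent h (peak P) r≤ = proj₂ (adding a) (inj₁ (inside (ℤ.≤-trans r≤
        (subst (profile (i ∷ w) k ≤_) (profile-peak i w h P) (ℤ.i≤i+j _ 1ℤ)))))
      bent h (straight eq) r≤ = proj₂ (adding a)
          (inj₁ (inside (subst (+ suc r ≤_) (profile-straight i w h eq) r≤)))
      from : + suc r ≤ profile (i ∷ w) k → (suc r , suc c) ∈ diagram κ′
      from r≤ = by-cases (hit? i k)
        where
        by-cases : Dec (Hit i k) → (suc r , suc c) ∈ diagram κ′
        by-cases (yes h) = bent h (bend w k) r≤
        by-cases (no h)  = proj₂ (adding a)
            (inj₁ (inside (subst (+ suc r ≤_) (profile-miss i w h) r≤)))

    -- A single peak at residue i rules out `Rises i w`, so the profile increases nowhere; at each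
    -- hit peak it loses just the corner.
    when-removing : ∃ (RemovableAt κ i) → ∀ r c → Goal r c
    when-removing (b₀ , removable₀ , residue₀) r c = to , from
      where
      a = b₀ , removable₀ , residue₀
      k = content (suc r , suc c)
      P₀ : Peak w (content b₀)
      P₀ = on-box b₀ removable₀
        where
        on-box : ∀ b → Removable (partition κ) b → Peak w (content b)
        on-box (zero , c) (∈κ , _) = ⊥-elim (ℕ.<⇒≱ (dg-1≤row (partition κ) ∈κ) ℕ.z≤n)
        on-box (suc r , zero) (∈κ , _) = ⊥-elim (ℕ.<⇒≱ (proj₁ ∈κ) ℕ.z≤n)
        on-box (suc r , suc c) rem = proj₁ (removable⇒peak R rem)
      ≤p : profile (i ∷ w) k ≤ profile w k
      ≤p with rises⊎falls i w
      ... | inj₂ F = profile-falls {i = i} {w} F k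
      ... | inj₁ rise = ⊥-elim (ℤ.<-asym (rise _ (hit⁺ (fromMod residue₀)))
        (ℤ.<-≤-trans (Peak.right<0 P₀) (Peak.left≥0 P₀)))
      bent : Hit i k → Bend w k → (suc r , suc c) ∈ diagram κ′ → + suc r ≤ profile (i ∷ w) k
      bent h (valley V) b∈κ′ = ℤ.≤-trans (below (proj₁ (proj₁ (removing a) b∈κ′)))
        (subst (profile w k ≤_) (sym (profile-valley i w h V)) (ℤ.i≤i+j _ 1ℤ))
      bent h (straight eq) b∈κ′ = subst (+ suc r ≤_) (sym (profile-straight i w h eq))
          (below (proj₁ (proj₁ (removing a) b∈κ′)))
      bent h (peak P) b∈κ′ with proj₁ (removing a) b∈κ′
      ... | b∈κ , kept = ≤-gap (<⇒+1≤ (ℤ.≤∧≢⇒< (below b∈κ) λ r≡ →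
              kept (peak⇒removable R P r≡ , hit⇒residue± (suc r , suc c) h)))
            (trans (cong (_- (+ suc r + 1ℤ)) (sym (profile-peak i w h P)))
              (solve 2 (λ p r → p :+ con 1ℤ :- (r :+ con 1ℤ) := p :- r) refl (profile (i ∷ w) k)
                  (+ suc r)))
      to : (suc r , suc c) ∈ diagram κ′ → + suc r ≤ profile (i ∷ w) k
      to b∈κ′ = by-cases (hit? i k)
        where
        by-cases : Dec (Hit i k) → + suc r ≤ profile (i ∷ w) k
        by-cases (yes h) = bent h (bend w k) b∈κ′
        by-cases (no h)  = subst (+ suc r ≤_) (sym (profile-miss i w h))
            (below (proj₁ (proj₁ (removing a) b∈κ′)))
      from : + suc r ≤ profile (i ∷ w) k → (suc r , suc c) ∈ diagram κ′
      from r≤ = proj₂ (removing a) (inside (ℤ.≤-trans r≤ ≤p) , λ { (rem , res) →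
        let P , r≡ = removable⇒peak R rem in
        ≰-+1 (subst (_≤ profile (i ∷ w) k)
            (trans r≡ (sym (profile-peak i w (residue±⇒hit (suc r , suc c) res) P))) r≤) })

    when-neither : ¬ ∃ (AddableAt κ i) → ¬ ∃ (RemovableAt κ i) → ∀ r c → Goal r c
    when-neither ¬add ¬rem r c =
      (λ b∈κ′ → subst (+ suc r ≤_) (sym same) (below (proj₁ (otherwise ¬add ¬rem) b∈κ′))) ,
      (λ r≤ → proj₂ (otherwise ¬add ¬rem) (inside (subst (+ suc r ≤_) same r≤)))
      where
      k = content (suc r , suc c)
      same : profile (i ∷ w) k ≡ profile w k
      same = by-cases (hit? i k) (bend w k)
        where
        by-cases : Dec (Hit i k) → Bend w k → profile (i ∷ w) k ≡ profile w k
        by-cases (no h)  _             = profile-miss i w h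
        by-cases (yes h) (valley V)    = ⊥-elim (¬add (valley⇒addableAt h V))
        by-cases (yes h) (peak P)      = ⊥-elim (¬rem (peak⇒removableAt h P))
        by-cases (yes h) (straight eq) = profile-straight i w h eq

    -- Membership in a diagram is decidable, hence the case distinction may be classical.
    represents-∷ : Represents (i ∷ w) (partition κ′)
    represents-∷ = record
      { below  = λ {r} {c} b∈ → decidable-stable (_ ℤ.≤? _) λ ¬below → ¬¬cases r c λ goal →
          ¬below (proj₁ goal b∈)
      ; inside = λ {r} {c} r≤ → decidable-stable (dg? (partition κ′) _) λ ¬inside →
          ¬¬cases r c λ goal → ¬inside (proj₂ goal r≤)
      }
      where
      ¬¬cases : ∀ r c → ¬ ¬ Goal r c
      ¬¬cases r c ¬goal = ¬goal
          (when-neither (λ a → ¬goal (when-adding a r c)) (λ a → ¬goal (when-removing a r c)) r c)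

  represents : ∀ (w : C̃ n) {κ} → w · emptyCore n ↦ κ → Represents w (partition κ)
  represents []      (κ⊆ , _) = record
    { below  = λ b∈ → ⊥-elim (ℕ.<⇒≱ (proj₁ (κ⊆ b∈)) (proj₂ (κ⊆ b∈)))
    ; inside = λ {r} {c} r≤ → ⊥-elim (small r c _ refl r≤)
    }
    where
    -- On the diagonal c - r the empty profile is at most r, below the row r + 1 of the box.
    small : ∀ r c k → content (suc r , suc c) ≡ k → ¬ + suc r ≤ profile {n} [] k
    small r c (+ _)    _  le = ℤ.<⇒≱ (+<+ (ℕ.s≤s ℕ.z≤n)) le
    small r c -[1+ m ] eq le = ≰-+1 {+ suc r}
        (≤-gap₂ (subst (λ x → + suc r ≤ - x) (sym eq) le) (+≤+ {0} {c} ℕ.z≤n)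
      (solve 2 (λ r c → :- (con 1ℤ :+ c :- r) :- r :+ (c :- con 0ℤ) := r :- (r :+ con 1ℤ)) refl
          (+ suc r) (+ c)))
  represents (i ∷ w) (κ″ , w↦κ″ , action) = represents-∷ (represents w w↦κ″) action

-- From strong covers to reflections

deleted-letter : ∀ {A : Set} {v u : List A} → v ⊑ u → suc (length v) ≡ length u →
  ∃ λ a → ∃₂ λ s b → u ≡ a ++ s ∷ b × v ≡ a ++ b
deleted-letter {u = s ∷ u} (s ∷ʳ v⊑u) len =
  [] , s , u , refl , Pointwise-≡⇒≡ (toPointwise (ℕ.suc-injective len) v⊑u)
deleted-letter {v = x ∷ v} (refl ∷ v⊑u) len =
  let a , s , b , u≡ , v≡ = deleted-letter v⊑u (ℕ.suc-injective len)
  in x ∷ a , s , b , cong (x ∷_) u≡ , cong (x ∷_) v≡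

module _ {n : ℕ} where

  open Represents

  -- If `w` had the larger value at k, the last box of `μ` on this diagonal, in row `profile w k`,
  -- would lie outside `ν`. Such a box exists because `profile u k` satisfies the bounds of `box-at`
  -- and is at most `profile w k - 1ℤ`.
  contained⇒profile-≤ : ∀ {w u : C̃ n} {μ ν} → Represents w μ → Represents u ν → dg μ ⊆ dg ν →
    ∀ k → profile w k ≤ profile u k
  contained⇒profile-≤ {w} {u} R S μ⊆ν k = ℤ.≮⇒≥ λ u<w → absurd u<w
    (box-at k (profile w k - 1ℤ) (ℤ.≤-trans (profile-≥0 u k) (u≤w-1 u<w))
        (ℤ.≤-trans (profile-≥- u k) (u≤w-1 u<w)))
    where
    u≤w-1 : profile u k < profile w k → profile u k ≤ profile w k - 1ℤ
    u≤w-1 u<w = ≤-gap (<⇒+1≤ u<w)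
      (solve 2 (λ w u → w :- (u :+ con 1ℤ) := w :- con 1ℤ :- u) refl (profile w k) (profile u k))
    absurd : profile u k < profile w k →
      ¬ (∃ λ r → ∃ λ c → content (suc r , suc c) ≡ k × + suc r ≡ profile w k - 1ℤ + 1ℤ)
    absurd u<w (r , c , refl , r≡) = ℤ.<⇒≱ u<w (subst (_≤ profile u k) r≡w
      (below S (μ⊆ν (inside R (ℤ.≤-reflexive r≡w)))))
      where
      r≡w : + suc r ≡ profile w k
      r≡w = trans r≡ (-1+1 (profile w k))

  profile-act : ∀ {v w : C̃ n} → act v ≗ act w → profile v ≗ profile w
  profile-act {v} {w} eq = profile-cong-signs v w (λ k → subst (_< 0ℤ) (inverse k))
      (λ k → subst (_< 0ℤ) (sym (inverse k)))
    where
    inverse : ∀ k → act⁻¹ v k ≡ act⁻¹ w k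
    inverse k = act-injective w (trans (sym (eq _)) (trans (act-act⁻¹ v k) (sym (act-act⁻¹ w k))))

  -- If two swapped steps were congruent, consecutive diagonals would both be hit. This is the
  -- source of i ≢ j in the theorem.
  σ-moves-off-class : ∀ (i : Fin (suc n)) {x} → σ i x ≢ x → ¬ x ≅ σ i x ⟨ 2 ℕ.* n ⟩
  σ-moves-off-class i {x} moved x≅ with view i x
  ... | up h     = hit-exclusive i (hit-≅ i (≅-sym (subst (x ≅_⟨ _ ⟩) (σ-up i h) x≅)) h) h
  ... | down h   = miss-1 i h (hit-≅ i (subst (x ≅_⟨ _ ⟩) (σ-down i h) x≅) h)
  ... | fix h h′ = moved (σ-fix i h h′)

  transposes-≗ : ∀ {x y s t} → s ≗ t → Transposes n x y t → Transposes n x y s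
  transposes-≗ {x} {y} s≗t T = record
    { equivariant = record
        { eq-⊕ = λ k q → trans (s≗t _)
            (trans (eq-⊕ equivariant k q) (cong (_+ q * + (2 ℕ.* n)) (sym (s≗t k))))
        ; eq-mirror = λ k → trans (s≗t _)
            (trans (eq-mirror equivariant k) (cong mirror (sym (s≗t k)))) }
    ; x↦y   = trans (s≗t x) x↦y
    ; y↦x   = trans (s≗t y) y↦x
    ; fixed = λ z a b c d → trans (s≗t z) (fixed z a b c d)
    }
    where open Transposes T

  module _ .{{_ : NonZero n}} where

    transposition : ∀ {x y} {t : C̃ n} → Transposes n x y (act t) →
        IsTransposition n (φ n x) (φ n y) t
    transposition {x} {y} {t} T = record
      { i↦j   = moves x y x↦y
      ; j↦i   = moves y x y↦x
      ; -i↦-j = λ q → subst₂ (λ a b → ⟦ t ⟧ (a + q * + period n) ≡ b + q * + period n)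
          (φ-mirror n x) (φ-mirror n y) (moves (mirror x) (mirror y) mx↦my q)
      ; -j↦-i = λ q → subst₂ (λ a b → ⟦ t ⟧ (a + q * + period n) ≡ b + q * + period n)
          (φ-mirror n y) (φ-mirror n x) (moves (mirror y) (mirror x) my↦mx q)
      ; fixed = λ z → fixes (position n z)
      }
      where
      open Transposes T
      moves : ∀ x y → act t x ≡ y → ∀ q → ⟦ t ⟧ (φ n x + q * + period n) ≡ φ n y + q * + period n
      moves x y x↦y q = trans (cong ⟦ t ⟧ (sym (φ-⊕ n x q))) (trans (⟦⟧-φ t _)
        (trans (cong (φ n) (trans (eq-⊕ equivariant x q) (cong (_+ q * + (2 ℕ.* n)) x↦y)))
            (φ-⊕ n y q)))
      fixes : ∀ {z} → Position n z → z ≢ φ n x [mod period n ] → z ≢ φ n y [mod period n ] →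
        z ≢ - φ n x [mod period n ] → z ≢ - φ n y [mod period n ] → ⟦ t ⟧ z ≡ z
      fixes (multiple z≅0) _ _ _ _ = ⟦⟧-multiple t z≅0
      fixes (value k) ≢x ≢y ≢-x ≢-y = trans (⟦⟧-φ t k) (cong (φ n) (fixed k
        (λ p → ≢x (toMod (φ-≅ n p))) (λ p → ≢y (toMod (φ-≅ n p)))
        (λ p → ≢-x (subst (φ n k ≡_[mod period n ]) (φ-mirror n x) (toMod (φ-≅ n p))))
        (λ p → ≢-y (subst (φ n k ≡_[mod period n ]) (φ-mirror n y) (toMod (φ-≅ n p))))))

    -- If deleting the letter s from a word of u leaves a word of w, then u and w differ by a
    -- conjugate of s, and this reflection is determined by any pair of points that it swaps.
    deletion⇒transposition : ∀ {w u : C̃ n} a s b → act w ≗ act (a ++ b) →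
        act u ≗ act (a ++ s ∷ b) →
      ∀ c → act⁻¹ u c ≢ act⁻¹ w c →
      ∃ λ t → Transposes n (act⁻¹ u c) (act⁻¹ w c) (act t) × u ≈ w ++ t ×
              ¬ act⁻¹ u c ≅ act⁻¹ w c ⟨ 2 ℕ.* n ⟩
    deletion⇒transposition {w} {u} a s b w≗ab u≗asb c x≢y =
      t , transposes-≗ t≗ T , act⇒≈ {v = u} {w ++ t}
          (λ k → trans (sym (w∘t k)) (sym (act-++ w t k))) ,
      λ x≅y → σ-moves-off-class s (λ eq → x≢y (act-injective b (trans (sym eq) σbx≡by)))
        (subst (act b x ≅_⟨ _ ⟩) (sym σbx≡by) (eq-≅ (act-equivariant b) x≅y))
      where
      x y : ℤ
      x = act⁻¹ u c
      y = act⁻¹ w c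
      t : C̃ n
      t = reverse b ++ s ∷ b
      t≗ : act t ≗ act⁻¹ b ∘ σ s ∘ act b
      t≗ k = trans (act-++ (reverse b) (s ∷ b) k) (act-reverse b _)
      w∘t : ∀ k → act w (act t k) ≡ act u k
      w∘t k = trans (w≗ab _) (trans (act-++ a b _) (trans (cong (act a)
        (trans (cong (act b) (t≗ k)) (act-act⁻¹ b _)))
            (trans (sym (act-++ a (s ∷ b) k)) (sym (u≗asb k)))))
      tx≡y : act t x ≡ y
      tx≡y = act-injective w (trans (w∘t x) (trans (act-act⁻¹ u c) (sym (act-act⁻¹ w c))))
      σbx≡by : σ s (act b x) ≡ act b y
      σbx≡by = trans (sym (act-act⁻¹ b _)) (cong (act b) (trans (sym (t≗ x)) tx≡y))
      T : Transposes n x y (act⁻¹ b ∘ σ s ∘ act b)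
      T = conjugate b (σ-transposes s σbx≡by (x≢y ∘ act-injective b))

  module _ {τ κ : SymmetricCore n} {w u : C̃ n}
           (R : Represents w (partition τ)) (S : Represents u (partition κ)) where

    -- An east neighbour in κ would belong to the same component, so the boundary of κ runs
    -- vertically to the right of b. A south neighbour outside τ would too, so b stands on τ or on
    -- the bottom edge, and the boundary of τ runs horizontally below b.
    south-east-end : ∀ b → SoutheastEnd (diagram κ ∖ diagram τ) b →
      act⁻¹ u (content b) < 0ℤ × 0ℤ ≤ act⁻¹ w (content b) × profile w (content b) < profile u
          (content b)
    south-east-end (zero , c) ((b∈κ , _) , _) = ⊥-elim (ℕ.<⇒≱ (dg-1≤row (partition κ) b∈κ) ℕ.z≤n)
    south-east-end (suc r , zero) ((b∈κ , _) , _) = ⊥-elim (ℕ.<⇒≱ (proj₁ b∈κ) ℕ.z≤n)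
    south-east-end (suc r , suc c) ((b∈κ , b∉τ) , extreme) = right-edge , bottom-edge , ℤ.<-≤-trans
        (above R b∉τ) (below S b∈κ)
      where
      k = content (suc r , suc c)
      east : (suc r , 2 ℕ.+ c) ∉ diagram κ
      east e∈κ = ℕ.<⇒≱ (ℕ.n<1+n (suc c)) (proj₂ (extreme (suc r , 2 ℕ.+ c)
        (((b∈κ , b∉τ) , (e∈κ , λ e∈τ → b∉τ (dg-west (partition τ) (ℕ.s≤s ℕ.z≤n) e∈τ)) ,
            inj₁ (refl , inj₁ refl)) ◅ ε)))
      south : ∀ r′ → r ≡ r′ → + r′ ≤ profile w (k + 1ℤ)
      south zero     _    = profile-≥0 w (k + 1ℤ)
      south (suc r′) refl = subst (λ l → + r ≤ profile w l) (content-south r (suc c))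
        (below R (decidable-stable (dg? (partition τ) (r , suc c)) λ s∉τ → ℕ.<⇒≱ (ℕ.n<1+n r)
          (proj₁ (extreme (r , suc c)
              (((b∈κ , b∉τ) , (dg-south (partition κ) (ℕ.s≤s ℕ.z≤n) b∈κ , s∉τ) ,
              inj₂ (refl , inj₂ refl)) ◅ ε)))))
      right-edge : act⁻¹ u k < 0ℤ
      right-edge with step u k
      ... | vertical lt _   = lt
      ... | horizontal _ eq = ⊥-elim
          (ℤ.<⇒≱ (subst (λ l → profile u l < + suc r) (content-east (suc r) (suc c)) (above S east))
        (subst (+ suc r ≤_) eq (below S b∈κ)))
      bottom-edge : 0ℤ ≤ act⁻¹ w k
      bottom-edge with step w k
      ... | horizontal ge _ = ge
      ... | vertical _ eq   = ⊥-elim (ℤ.<⇒≱ (above R b∉τ) (subst₂ _≤_ (ℤ.+-comm (+ r) 1ℤ) (sym eq)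
        (ℤ.+-monoˡ-≤ 1ℤ (south r refl))))

theorem3p16 : (n : ℕ) .{{_ : NonZero n}} → 2 ℕ.≤ n →
    (τ κ : SymmetricCore n) (c : ℤ) → StrongMarkedCover τ c κ →
    (w u : C̃⁰ n) → 𝔞 w ↦ τ → 𝔞 u ↦ κ →
    ∃ λ (i : ℤ) → ∃ λ (j : ℤ) →
    (i ≢ + 0 [mod suc n ]) × (j ≢ + 0 [mod suc n ]) × (i ≢ j [mod period n ]) ×
    (∃ λ (t : C̃ n) → IsTransposition n i j t × (proj₁ u ≈ proj₁ w ++ t)) ×
    (⟦ proj₁ w ⟧ j ≡ c + (c /ℕ n) + + 1) ×
    (⟦ proj₁ u ⟧ i ≡ c + (c /ℕ n) + + 1)
theorem3p16 n _ τ κ c record { cover = cover ; marking = b , end , refl } (w , w-min)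
    (u , u-min) w↦τ u↦κ =
  φ n (act⁻¹ u c) , φ n (act⁻¹ w c) , φ-nonmultiple n _ , φ-nonmultiple n _ ,
  ≇ ∘ φ-≅⁻¹ n ∘ fromMod ,
  (t , transposition T , u≈wt) ,
  value-at w , value-at u
  where
  open StrongCover cover
  R = represents w w↦τ
  S = represents u u↦κ
  edges = south-east-end {τ = τ} {κ} R S b end
  -- Both required values are `φ n c`, as each word sends its own preimage of step c back to c.
  value-at : ∀ v → ⟦ v ⟧ (φ n (act⁻¹ v c)) ≡ c + (c /ℕ n) + + 1
  value-at v = trans (⟦⟧-φ v (act⁻¹ v c)) (trans (cong (φ n) (act-act⁻¹ v c)) (φ-def n c))
  -- Injectivity of 𝔞: the lengths in the cover belong to its own preimages and have to be
  -- transferred to `w` and `u`.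
  same-core : ∀ {v w : C̃ n} {μ} → Represents v μ → Represents w μ →
    AffineGrassmannian v → AffineGrassmannian w → act v ≗ act w
  same-core {v} {w} Rv Rw v-min w-min = ascending-unique (grassmannian-ascending v v-min)
      (grassmannian-ascending w w-min)
    λ k → ℤ.≤-antisym (contained⇒profile-≤ Rv Rw (λ p → p) k)
        (contained⇒profile-≤ Rw Rv (λ p → p) k)
  τ₀ κ₀ v : C̃ n
  τ₀ = proj₁ 𝔞⁻¹τ
  κ₀ = proj₁ 𝔞⁻¹κ
  τ₀≗w : act τ₀ ≗ act w
  τ₀≗w = same-core (represents τ₀ preimageτ) R (proj₂ 𝔞⁻¹τ) w-min
  κ₀≗u : act κ₀ ≗ act u
  κ₀≗u = same-core (represents κ₀ preimageκ) S (proj₂ 𝔞⁻¹κ) u-min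
  v = proj₁ (proj₁ lengthκ)
  |v| : length v ≡ ℓτ ℕ.+ 1
  |v| = proj₂ (proj₂ (proj₁ lengthκ))
  v≗u : act v ≗ act u
  v≗u k = trans (≈⇒act {v = v} {κ₀} (proj₁ (proj₂ (proj₁ lengthκ))) k) (κ₀≗u k)
  profile-v≗u = profile-act {v = v} {u} v≗u
  subword-τ = subword v w λ k →
      ℤ.≤-trans (contained⇒profile-≤ R S contained k) (ℤ.≤-reflexive (sym (profile-v≗u k)))
  sorted-τ = sort (proj₁ subword-τ)
  x : C̃ n
  x = proj₁ sorted-τ
  x⊑v : x ⊑ v
  x⊑v = ⊑-trans (proj₁ (proj₂ sorted-τ)) (proj₁ (proj₂ subword-τ))
  profile-x : profile x ≗ profile w
  profile-x k = trans (proj₂ (proj₂ (proj₂ sorted-τ)) k) (proj₂ (proj₂ subword-τ) k)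
  w≗x : act w ≗ act x
  w≗x = ascending-unique (grassmannian-ascending w w-min) (proj₁ (proj₂ (proj₂ sorted-τ)))
      (sym ∘ profile-x)
  |x|≥ : ℓτ ℕ.≤ length x
  |x|≥ = proj₂ lengthτ x (act⇒≈ {v = x} {τ₀} λ k → trans (sym (w≗x k)) (sym (τ₀≗w k)))
  -- With equal lengths x would be all of v, but the profiles of τ and κ differ at c.
  |x|≢|v| : length x ≢ length v
  |x|≢|v| eq = ℤ.<-irrefl (trans (sym (profile-x c)) (trans (cong (λ y → profile y c)
    (Pointwise-≡⇒≡ (toPointwise eq x⊑v))) (profile-v≗u c))) (proj₂ (proj₂ edges))
  1+|x|≡|v| : suc (length x) ≡ length v
  1+|x|≡|v| = ℕ.≤-antisym (ℕ.≤∧≢⇒< (length-mono-≤ x⊑v) |x|≢|v|)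
    (subst (ℕ._≤ suc (length x)) (sym (trans |v| (ℕ.+-comm ℓτ 1))) (ℕ.s≤s |x|≥))
  deletion = deleted-letter x⊑v 1+|x|≡|v|
  result = deletion⇒transposition {w = w} {u} (proj₁ deletion) (proj₁ (proj₂ deletion))
      (proj₁ (proj₂ (proj₂ deletion)))
    (λ k → trans (w≗x k) (cong (λ y → act y k) (proj₂ (proj₂ (proj₂ (proj₂ deletion))))))
    (λ k → trans (sym (v≗u k)) (cong (λ y → act y k) (proj₁ (proj₂ (proj₂ (proj₂ deletion))))))
    c (λ eq → ℤ.<-irrefl eq (ℤ.<-≤-trans (proj₁ edges) (proj₁ (proj₂ edges))))
  t = proj₁ result
  T = proj₁ (proj₂ result)
  u≈wt = proj₁ (proj₂ (proj₂ result))
  ≇ = proj₂ (proj₂ (proj₂ result))
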